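{- Let $P:H_0(\tilde S_N)\to\operatorname{NDPF}^{(1)}_N$ be the monoid morphism with $P(\pi_i)=f_i$ for $i\in\{0,\dots,N-1\}$. For every $g\in \operatorname{NDPF}^{(1)}_N$, the fiber $\{w\in\tilde S_N: P(\pi_w)=g\}$ contains a unique $[321]$-avoiding affine permutation.
   Context: $\tilde S_N$ is the group of bijections $\sigma:\mathbb{Z}\to\mathbb{Z}$ with $\sigma(i+N)=\sigma(i)+N$ and $\sum_{i=1}^N\sigma(i)=\binom{N+1}{2}$, generated by $s_0,\dots,s_{N-1}$ where $s_i$ exchanges $j,j+1$ for all $j\equiv i\pmod N$ (indices mod $N$). $H_0(\tilde S_N)$ is generated by $\pi_i$, $i\in\mathbb{Z}/N$, with $\pi_i^2=\pi_i$, $\pi_i\pi_j=\pi_j\pi_i$ for $i,j$ non-adjacent mod $N$, and $\pi_i\pi_{i+1}\pi_i=\pi_{i+1}\pi_i\pi_{i+1}$; $\pi_w=\pi_{i_1}\cdots\pi_{i_k}$ for a reduced word $w=s_{i_1}\cdots s_{i_k}$, a bijection with $\tilde S_N$. An affine permutation $x$ is $[321]$-avoiding if there are no integers $a<b<c$ with $x(a)>x(b)>x(c)$. $\operatorname{NDPF}^{(1)}_N$ is the set of $f:\mathbb{Z}\to\mathbb{Z}$ that are regressive ($f(i)\le i$), order preserving and skew periodic ($f(i+N)=f(i)+N$), other than the shifts $i\mapsto i-t$ with $t\ne0$; functions act on the right, so $j.(fg)=(j.f).g$ (apply $f$ first). For $i\in\{0,\dots,N-1\}$, $f_i$ is the function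 with $f_i(j)=j-1$ if $j\equiv i+1\pmod N$ and $f_i(j)=j$ otherwise. -}

module Defs where

open import Algebra.Bundles using (Monoid)
open import Algebra.Morphism.Structures using (module MonoidMorphisms)
open import Data.Bool.Base using (if_then_else_)
open import Data.Fin.Base using (Fin; toℕ)
open import Data.Integer.Base hiding (suc)
open import Data.Integer.Divisibility.Signed
open import Data.Integer.Properties
open import Data.Integer.Tactic.RingSolver using (solve-∀)
open import Data.List.Base using (List; []; _∷_; _++_; foldr; map; upTo; length)
import Data.List.Properties as List
open import Data.Nat.Base as ℕ using (ℕ; zero; suc)
open import Data.Nat.Combinatorics using (_C_)
import Data.Nat.Divisibility as ℕ
import Data.Nat.Properties as ℕ
open import Data.Product.Base using (_×_; _,_; proj₁; proj₂; ∃)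
open import Data.Sum.Base using (_⊎_; inj₁; inj₂)
open import Function.Definitions using (Bijective)
open import Level using (0ℓ)
open import Relation.Binary.Definitions using (Decidable)
open import Relation.Binary.PropositionalEquality
open import Relation.Nullary using (¬_; Dec; yes; no; contradiction)
open import Relation.Nullary.Decidable using (⌊_⌋; map′)

-- The braid relation between adjacent generators is imposed, so N ≥ 3:
-- for N = 2 the group is infinite dihedral and f₀f₁f₀ ≢ f₁f₀f₁.

module Affine (N : ℕ) (3≤N : 3 ℕ.≤ N) where

  infix 4 _≅_ _≅?_

  -- Congruence mod N; a record rather than a synonym so that a and b can be
  -- inferred.
  record _≅_ (a b : ℤ) : Set where
    constructor mod
    field N∣a-b : + N ∣ a - b

  _≅?_ : Decidable _≅_
  a ≅? b = map′ mod _≅_.N∣a-b (+ N ∣? a - b)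

  -- Generators are indexed by representatives 0, …, N-1 of ℤ/N.
  ι : Fin N → ℤ
  ι i = + toℕ i

  SkewPeriodic : (ℤ → ℤ) → Set
  SkewPeriodic f = ∀ i → f (i + + N) ≡ f i + + N

  Word : Set
  Word = List (Fin N)

  -- σ 1 + … + σ N
  windowSum : (ℤ → ℤ) → ℤ
  windowSum σ = foldr _+_ 0ℤ (map (λ k → σ (+ suc k)) (upTo N))

  record AffinePerm : Set where
    field
      fun       : ℤ → ℤ
      bijective : Bijective _≡_ _≡_ fun
      periodic  : SkewPeriodic fun
      window    : windowSum fun ≡ + (suc N C 2)

  open AffinePerm public using (fun)

  infix 4 _≈S_ _≈F_ _≈H_

  _≈S_ : AffinePerm → AffinePerm → Set
  v ≈S w = ∀ j → fun v j ≡ fun w j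

  s : Fin N → ℤ → ℤ
  s i j = if ⌊ j ≅? ι i ⌋ then j + 1ℤ
          else if ⌊ j ≅? ι i + 1ℤ ⌋ then j - 1ℤ
          else j

  -- j . (s_{i₁} ⋯ s_{iₖ}), a right action: s_{i₁} is applied first.
  -- (With the other convention every w is replaced by w⁻¹, which does not
  -- affect 321-avoidance.)
  infixl 6 _·_
  _·_ : ℤ → Word → ℤ
  j · []      = j
  j · (i ∷ u) = s i j · u

  _IsWordFor_ : Word → AffinePerm → Set
  u IsWordFor w = ∀ j → j · u ≡ fun w j

  _IsReducedWordFor_ : Word → AffinePerm → Set
  u IsReducedWordFor w =
    u IsWordFor w × (∀ v → v IsWordFor w → length u ℕ.≤ length v)

  Avoids321 : AffinePerm → Set
  Avoids321 x =
    ¬ (∃ λ a → ∃ λ b → ∃ λ c →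
       a < b × b < c × fun x a > fun x b × fun x b > fun x c)

  -- The 0-Hecke monoid is presented as words in the π_i modulo the
  -- congruence generated by the defining relations.
  data _≈H_ : Word → Word → Set where
    ≈H-refl  : ∀ {u} → u ≈H u
    ≈H-sym   : ∀ {u v} → u ≈H v → v ≈H u
    ≈H-trans : ∀ {u v w} → u ≈H v → v ≈H w → u ≈H w
    ++-cong  : ∀ {u u′ v v′} → u ≈H u′ → v ≈H v′ → u ++ v ≈H u′ ++ v′
    idem     : ∀ i → i ∷ i ∷ [] ≈H i ∷ []
    comm     : ∀ i j → ¬ ι j ≅ ι i + 1ℤ → ¬ ι i ≅ ι j + 1ℤ →
               i ∷ j ∷ [] ≈H j ∷ i ∷ []
    braid    : ∀ i j → ι j ≅ ι i + 1ℤ →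
               i ∷ j ∷ i ∷ [] ≈H j ∷ i ∷ j ∷ []

  H₀ : Monoid 0ℓ 0ℓ
  H₀ = record
    { Carrier  = Word
    ; _≈_      = _≈H_
    ; _∙_      = _++_
    ; ε        = []
    ; isMonoid = record
      { isSemigroup = record
        { isMagma = record
          { isEquivalence = record
            { refl = ≈H-refl ; sym = ≈H-sym ; trans = ≈H-trans }
          ; ∙-cong = ++-cong }
        ; assoc = λ u v w → ≈H-reflexive (List.++-assoc u v w) }
      ; identity = (λ _ → ≈H-refl)
                 , (λ u → ≈H-reflexive (List.++-identityʳ u)) }
    }
    where
    ≈H-reflexive : ∀ {u v} → u ≡ v → u ≈H v
    ≈H-reflexive refl = ≈H-refl

  module H₀ = Monoid H₀

  π : Fin N → H₀.Carrier
  π i = i ∷ []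

  -- h is π_w, i.e. h = π_{i₁} ⋯ π_{iₖ} for a reduced word s_{i₁} ⋯ s_{iₖ}
  -- of w.  It is a relation because a reduced word is not chosen; by
  -- Matsumoto's theorem it is functional up to _≈H_.
  _Isπ[_] : H₀.Carrier → AffinePerm → Set
  h Isπ[ w ] =
    ∃ λ u → u IsReducedWordFor w × h H₀.≈ foldr (λ i → π i H₀.∙_) H₀.ε u

  record NDPF : Set where
    field
      app             : ℤ → ℤ
      regressive      : ∀ i → app i ≤ i
      orderPreserving : ∀ {i j} → i ≤ j → app i ≤ app j
      skewPeriodic    : SkewPeriodic app
      notShift        : ∀ t → t ≢ 0ℤ → ¬ (∀ i → app i ≡ i - t)

  open NDPF public

  _≈F_ : NDPF → NDPF → Set
  f ≈F g = ∀ j → app f j ≡ app g j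

  idF : NDPF
  idF = record
    { app             = λ j → j
    ; regressive      = λ _ → ≤-refl
    ; orderPreserving = λ i≤j → i≤j
    ; skewPeriodic    = λ _ → refl
    ; notShift        = λ t t≢0 e →
        t≢0 (neg-injective (trans (sym (+-identityˡ (- t))) (sym (e 0ℤ))))
    }

  -- If the composite of f followed by g is a shift then f is strictly
  -- increasing, so by skew periodicity f is itself a shift, hence the
  -- identity, and then g is a shift.
  module Composite (f g : NDPF)
    (t : ℤ) (shift : ∀ j → app g (app f j) ≡ j - t) where

    strict : ∀ j → app f j + 1ℤ ≤ app f (j + 1ℤ)
    strict j = subst (_≤ app f (j + 1ℤ)) (+-comm 1ℤ (app f j))
      (i<j⇒suc[i]≤j (≤∧≢⇒< (orderPreserving f (i≤i+j j 1ℤ)) neq))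
      where
      neq : app f j ≢ app f (j + 1ℤ)
      neq e = i≢suc[i] (trans (+-cancelʳ (- t) j (j + 1ℤ)
        (trans (sym (shift j)) (trans (cong (app g) e) (shift (j + 1ℤ)))))
        (+-comm j 1ℤ))
        where
        +-cancelʳ : ∀ c a b → a + c ≡ b + c → a ≡ b
        +-cancelʳ c a b e = trans (lem a c) (trans (cong (_- c) e) (sym (lem b c)))
          where
          lem : ∀ a c → a ≡ (a + c) + - c
          lem = solve-∀

    steps : ∀ j k → app f j + + k ≤ app f (j + + k)
    steps j zero    = ≤-reflexive (trans (+-identityʳ _)
                        (cong (app f) (sym (+-identityʳ j))))
    steps j (suc k) = ≤-trans
      (≤-reflexive (lem (app f j) (+ k)))
      (≤-trans (+-monoˡ-≤ 1ℤ (steps j k))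
      (≤-trans (strict (j + + k))
      (≤-reflexive (cong (app f) (sym (lem j (+ k)))))))
      where
      lem : ∀ a k → a + (1ℤ + k) ≡ a + k + 1ℤ
      lem = solve-∀

    1+pred : 1ℤ + + (N ℕ.∸ 1) ≡ + N
    1+pred = cong +_ (ℕ.m+[n∸m]≡n (ℕ.≤-trans (ℕ.s≤s ℕ.z≤n) 3≤N))

    step : ∀ j → app f (j + 1ℤ) ≡ app f j + 1ℤ
    step j = ≤-antisym upper (strict j)
      where
      M = + (N ℕ.∸ 1)

      cancel : ∀ a b → a + M ≤ b + M → a ≤ b
      cancel a b le = subst₂ _≤_ (lem a M) (lem b M) (+-monoˡ-≤ (- M) le)
        where
        lem : ∀ a c → (a + c) + - c ≡ a
        lem = solve-∀

      assoc′ : ∀ a → a + 1ℤ + M ≡ a + + N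
      assoc′ a = trans (+-assoc a 1ℤ M) (cong (λ x → a + x) 1+pred)

      upper : app f (j + 1ℤ) ≤ app f j + 1ℤ
      upper = cancel _ _ (≤-trans (steps (j + 1ℤ) (N ℕ.∸ 1))
        (≤-reflexive (trans (cong (app f) (assoc′ j))
          (trans (skewPeriodic f j) (sym (assoc′ (app f j)))))))

    exact : ∀ j k → app f (j + + k) ≡ app f j + + k
    exact j zero    = trans (cong (app f) (+-identityʳ j)) (sym (+-identityʳ _))
    exact j (suc k) = trans (cong (app f) (lem j (+ k)))
      (trans (step (j + + k)) (trans (cong (_+ 1ℤ) (exact j k))
        (sym (lem (app f j) (+ k)))))
      where
      lem : ∀ a k → a + (1ℤ + k) ≡ a + k + 1ℤ
      lem = solve-∀

    f-shift : ∀ j → app f j ≡ j - (- app f 0ℤ)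
    f-shift (+ k) = trans (cong (app f) (sym (+-identityˡ (+ k))))
      (trans (exact 0ℤ k) (lem (app f 0ℤ) (+ k)))
      where
      lem : ∀ a k → a + k ≡ k + - (- a)
      lem = solve-∀
    f-shift j@(-[1+ k ]) = trans (lem (app f j) (+ suc k))
      (cong (λ a → j + - (- a)) (trans (sym (exact j (suc k)))
        (cong (app f) (+-inverseˡ (+ suc k)))))
      where
      lem : ∀ a k → a ≡ - k + - (- (a + k))
      lem = solve-∀

    f-id : ∀ j → app f j ≡ j
    f-id j with - app f 0ℤ ≟ 0ℤ
    ... | yes e = trans (f-shift j) (trans (cong (λ a → j - a) e) (+-identityʳ j))
    ... | no ne = contradiction f-shift (notShift f _ ne)

    g-shift : ∀ j → app g j ≡ j - t
    g-shift j = trans (cong (app g) (sym (f-id j))) (shift j)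

  -- Right action: f ∘F g applies f first.
  infixl 7 _∘F_

  _∘F_ : NDPF → NDPF → NDPF
  f ∘F g = record
    { app             = λ j → app g (app f j)
    ; regressive      = λ j → ≤-trans (regressive g (app f j)) (regressive f j)
    ; orderPreserving = λ i≤j → orderPreserving g (orderPreserving f i≤j)
    ; skewPeriodic    = λ j →
        trans (cong (app g) (skewPeriodic f j)) (skewPeriodic g (app f j))
    ; notShift        = λ t t≢0 e → notShift g t t≢0 (Composite.g-shift f g t e)
    }

  NDPF⁽¹⁾ : Monoid 0ℓ 0ℓ
  NDPF⁽¹⁾ = record
    { Carrier  = NDPF
    ; _≈_      = _≈F_
    ; _∙_      = _∘F_
    ; ε        = idF
    ; isMonoid = record
      { isSemigroup = record
        { isMagma = record
          { isEquivalence = record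
            { refl  = λ _ → refl
            ; sym   = λ e j → sym (e j)
            ; trans = λ e e′ j → trans (e j) (e′ j) }
          ; ∙-cong = λ {f} {f′} {g} {g′} e e′ j →
              trans (cong (app g) (e j)) (e′ (app f′ j)) }
        ; assoc = λ _ _ _ _ → refl }
      ; identity = (λ _ _ → refl) , (λ _ _ → refl) }
    }

  module NDPF⁽¹⁾ = Monoid NDPF⁽¹⁾

  f-fun : Fin N → ℤ → ℤ
  f-fun i j = if ⌊ j ≅? ι i + 1ℤ ⌋ then j - 1ℤ else j

  f-hit : ∀ i {j} → j ≅ ι i + 1ℤ → f-fun i j ≡ j - 1ℤ
  f-hit i {j} p with j ≅? ι i + 1ℤ
  ... | yes _ = refl
  ... | no ¬p = contradiction p ¬p

  f-miss : ∀ i {j} → ¬ j ≅ ι i + 1ℤ → f-fun i j ≡ j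
  f-miss i {j} ¬p with j ≅? ι i + 1ℤ
  ... | yes p = contradiction p ¬p
  ... | no _  = refl

  ≅-sym : ∀ {a b} → a ≅ b → b ≅ a
  ≅-sym {a} {b} (mod p) = mod (subst (+ N ∣_) (lem a b) (∣m⇒∣-m p))
    where
    lem : ∀ a b → - (a + - b) ≡ b + - a
    lem = solve-∀

  ≅-trans : ∀ {a b c} → a ≅ b → b ≅ c → a ≅ c
  ≅-trans {a} {b} {c} (mod p) (mod q) =
    mod (subst (+ N ∣_) (lem a b c) (∣m∣n⇒∣m+n p q))
    where
    lem : ∀ a b c → (a + - b) + (b + - c) ≡ a + - c
    lem = solve-∀

  ≅-+ : ∀ c {a b} → a ≅ b → a + c ≅ b + c
  ≅-+ c {a} {b} (mod p) = mod (subst (+ N ∣_) (lem a b c) p)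
    where
    lem : ∀ a b c → a + - b ≡ (a + c) + - (b + c)
    lem = solve-∀

  ≅-reflexive : ∀ {a b} → a ≡ b → a ≅ b
  ≅-reflexive {a} refl = mod (divides 0ℤ (+-inverseʳ a))

  ≅-pred : ∀ {a b} → a ≅ b + 1ℤ → a - 1ℤ ≅ b
  ≅-pred {a} {b} p = ≅-trans (≅-+ -1ℤ p) (≅-reflexive (lem b))
    where
    lem : ∀ b → b + 1ℤ + -1ℤ ≡ b
    lem = solve-∀

  ≅-N : ∀ a → a + + N ≅ a
  ≅-N a = mod (divides 1ℤ (trans (lem a (+ N)) (sym (*-identityˡ (+ N)))))
    where
    lem : ∀ a n → a + n + - a ≡ n
    lem = solve-∀

  ≇-small : ∀ {a} k → 1 ℕ.≤ k → k ℕ.≤ 2 → ¬ a ≅ a + + k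
  ≇-small {a} (suc k) _ k≤2 p = ℕ.>⇒∤ (ℕ.≤-<-trans k≤2 3≤N)
    (∣⇒∣ᵤ (subst (+ N ∣_) (lem a (+ suc k)) (_≅_.N∣a-b (≅-sym p))))
    where
    lem : ∀ a k → a + k + - a ≡ k
    lem = solve-∀

  ≇-suc : ∀ {a} → ¬ a ≅ a + 1ℤ
  ≇-suc = ≇-small 1 ℕ.≤-refl (ℕ.s≤s ℕ.z≤n)

  f : Fin N → NDPF
  f i = record
    { app             = f-fun i
    ; regressive      = reg
    ; orderPreserving = mono
    ; skewPeriodic    = skew
    ; notShift        = λ t t≢0 e → t≢0 (neg-injective
        (lem (ι i) (- t) (trans (sym (e (ι i))) (f-miss i ≇-suc))))
    }
    where
    lem : ∀ a b → a + b ≡ a → b ≡ 0ℤ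
    lem a b e = trans (cancel a b) (trans (cong (λ x → - a + x) e) (+-inverseˡ a))
      where
      cancel : ∀ a b → b ≡ - a + (a + b)
      cancel = solve-∀

    reg : ∀ j → f-fun i j ≤ j
    reg j with j ≅? ι i + 1ℤ
    ... | yes _ = i-j≤i j 1ℤ
    ... | no _  = ≤-refl

    mono : ∀ {j k} → j ≤ k → f-fun i j ≤ f-fun i k
    mono {j} {k} j≤k with j ≅? ι i + 1ℤ | k ≅? ι i + 1ℤ
    ... | yes _ | yes _ = +-monoˡ-≤ -1ℤ j≤k
    ... | yes _ | no _  = ≤-trans (i-j≤i j 1ℤ) j≤k
    ... | no _  | no _  = j≤k
    ... | no ¬p | yes p = subst (j ≤_) (+-comm -1ℤ k)
          (i<j⇒i≤pred[j] (≤∧≢⇒< j≤k (λ { refl → ¬p p })))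

    skew : SkewPeriodic (f-fun i)
    skew j with j ≅? ι i + 1ℤ
    ... | yes p = trans (f-hit i (≅-trans (≅-N j) p)) (swap j (+ N))
      where
      swap : ∀ a b → a + b + -1ℤ ≡ a + -1ℤ + b
      swap = solve-∀
    ... | no ¬p = f-miss i (λ p → ¬p (≅-trans (≅-sym (≅-N j)) p))

  P : H₀.Carrier → NDPF⁽¹⁾.Carrier
  P = foldr (λ i → f i NDPF⁽¹⁾.∙_) NDPF⁽¹⁾.ε

  P-π : ∀ i → P (π i) NDPF⁽¹⁾.≈ f i
  P-π i _ = refl

  P-++ : ∀ u v → P (u ++ v) NDPF⁽¹⁾.≈ P u NDPF⁽¹⁾.∙ P v
  P-++ []      v j = refl
  P-++ (i ∷ u) v j = P-++ u v (f-fun i j)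

  f-idem : ∀ i j → f-fun i (f-fun i j) ≡ f-fun i j
  f-idem i j with j ≅? ι i + 1ℤ
  ... | yes p = f-miss i (λ q → ≇-suc {ι i} (≅-trans (≅-sym (≅-pred p)) q))
  ... | no ¬p = f-miss i ¬p

  f-comm : ∀ i j → ¬ ι j ≅ ι i + 1ℤ → ¬ ι i ≅ ι j + 1ℤ →
           ∀ k → f-fun j (f-fun i k) ≡ f-fun i (f-fun j k)
  f-comm i j a b k with k ≅? ι i + 1ℤ | k ≅? ι j + 1ℤ
  ... | yes p | yes q = trans
          (f-miss j (λ r → b (≅-trans (≅-sym (≅-pred p)) r)))
          (sym (f-miss i (λ r → a (≅-trans (≅-sym (≅-pred q)) r))))
  ... | yes p | no ¬q = trans
          (f-miss j (λ r → b (≅-trans (≅-sym (≅-pred p)) r)))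
          (sym (f-hit i p))
  ... | no ¬p | yes q = trans (f-hit j q)
          (sym (f-miss i (λ r → a (≅-trans (≅-sym (≅-pred q)) r))))
  ... | no ¬p | no ¬q = trans (f-miss j ¬q) (sym (f-miss i ¬p))

  f-braid : ∀ i j → ι j ≅ ι i + 1ℤ → ∀ k →
            f-fun i (f-fun j (f-fun i k)) ≡ f-fun j (f-fun i (f-fun j k))
  f-braid i j a k = go (k ≅? ι i + 1ℤ) (k ≅? ι j + 1ℤ)
    where
    -- k ≡ i forces k ≢ j + 1 = i + 2.
    not-j : ∀ {k} → k ≅ ι i → ¬ k ≅ ι j + 1ℤ
    not-j p q = ≇-small {ι i} 2 (ℕ.s≤s ℕ.z≤n) ℕ.≤-refl
      (≅-trans (≅-sym p) (≅-trans q
        (≅-trans (≅-+ 1ℤ a) (≅-reflexive (+-assoc (ι i) 1ℤ 1ℤ)))))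

    chain : ∀ a b c {k₀ k₁ k₂ k₃} → f-fun a k₀ ≡ k₁ → f-fun b k₁ ≡ k₂ →
            f-fun c k₂ ≡ k₃ → f-fun c (f-fun b (f-fun a k₀)) ≡ k₃
    chain a b c e₁ e₂ e₃ =
      trans (cong (λ x → f-fun c (f-fun b x)) e₁)
        (trans (cong (f-fun c) e₂) e₃)

    go : Dec (k ≅ ι i + 1ℤ) → Dec (k ≅ ι j + 1ℤ) →
         f-fun i (f-fun j (f-fun i k)) ≡ f-fun j (f-fun i (f-fun j k))
    go (yes p) (yes q) = contradiction
      (≅-trans (≅-trans a (≅-sym p)) q) ≇-suc
    go (yes p) (no ¬q) = trans
      (chain i j i (f-hit i p) (f-miss j (not-j (≅-pred p)))
        (f-miss i (λ r → ≇-suc {ι i} (≅-trans (≅-sym (≅-pred p)) r))))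
      (sym (chain j i j (f-miss j ¬q) (f-hit i p)
        (f-miss j (not-j (≅-pred p)))))
    go (no ¬p) (yes q) = trans
      (chain i j i (f-miss i ¬p) (f-hit j q) (f-hit i q′))
      (sym (chain j i j (f-hit j q) (f-hit i q′)
        (f-miss j (not-j (≅-pred q′)))))
      where
      q′ : k - 1ℤ ≅ ι i + 1ℤ
      q′ = ≅-trans (≅-pred q) a
    go (no ¬p) (no ¬q) = trans
      (chain i j i (f-miss i ¬p) (f-miss j ¬q) (f-miss i ¬p))
      (sym (chain j i j (f-miss j ¬q) (f-miss i ¬p) (f-miss j ¬q)))

  P-cong : ∀ {u v} → u H₀.≈ v → P u NDPF⁽¹⁾.≈ P v
  P-cong ≈H-refl         k = refl
  P-cong (≈H-sym e)      k = sym (P-cong e k)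
  P-cong (≈H-trans e e′) k = trans (P-cong e k) (P-cong e′ k)
  P-cong (++-cong {u} {u′} {v} {v′} e e′) k =
    trans (P-++ u v k) (trans (cong (app (P v)) (P-cong e k))
      (trans (P-cong e′ (app (P u′) k)) (sym (P-++ u′ v′ k))))
  P-cong (idem i)        k = f-idem i k
  P-cong (comm i j a b)  k = f-comm i j a b k
  P-cong (braid i j a)   k = f-braid i j a k

  open MonoidMorphisms H₀.rawMonoid NDPF⁽¹⁾.rawMonoid

  P-isMonoidHomomorphism : IsMonoidHomomorphism P
  P-isMonoidHomomorphism = record
    { isMagmaHomomorphism = record
      { isRelHomomorphism = record { cong = P-cong }
      ; homo              = P-++ }
    ; ε-homo = λ _ → refl
    }

  _InFiberOver_ : AffinePerm → NDPF → Set
  w InFiberOver g = ∃ λ h → h Isπ[ w ] × P h NDPF⁽¹⁾.≈ g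

-- For a reduced word of w, the function P π_w is the suffix minimum
-- j ↦ min { w k | k ≥ j }.  In a fiber element x, the values at suffix minima
-- are therefore prescribed by g; if x avoids 321 the remaining values are
-- increasing, which together with the window sum determines x.  Conversely,
-- take a shortest word u with P u = g.  If its permutation contained a 321
-- pattern, deleting a letter at which the two larger entries cross would
-- exchange them without changing the suffix minima, giving a shorter word.

module Submission where

open import Defs

-- The suffix minimum formula is a property of words: `i ∷ i ∷ []` acts as the identity, yet `P`
-- sends it to `f i`. Words for which it holds are called compatible. A word with a letter deleted
-- may fail it, and then need not be sent to `g`. Two reductions, neither lengthening a word,
-- restore compatibility: one keeps the value of `P`, the other keeps the permutation. The second
-- turns minimality among the words sent to `g` into minimality among all words whose permutation
-- has suffix minimum `g`, which yields both reducedness and 321-avoidance.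
--
-- The window sum enters because the nonminimal positions, if there are any, have no first one: two
-- candidates take the same values there, both in increasing order, and could still differ by a
-- shift along this sequence. A shift moves all these values in one direction, and the sum detects
-- it.
--
-- That some word is sent to `g` at all comes from splitting off generators on the right: unless `g`
-- is the identity it skips a value, which leaves room to raise part of it.

module IntegerSums where

  open import Algebra.Bundles using (AbelianGroup)
  open import Data.Integer.Base hiding (suc)
  open import Data.Integer.Properties
  open import Data.Integer.Tactic.RingSolver using (solve-∀)
  open import Data.List.Base using (foldr; map; upTo; applyUpTo)
  import Data.List.Properties as List
  open import Data.Nat.Base as ℕ using (ℕ; zero; suc)
  open import Data.Nat.Combinatorics using (_C_; nC1≡n; nCk+nC[k+1]≡[n+1]C[k+1])
  import Data.Nat.Properties as ℕ
  open import Relation.Binary.PropositionalEquality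

  open import Algebra.Properties.Group (AbelianGroup.group +-0-abelianGroup) public
    using () renaming (∙-cancelˡ to +-cancelˡ; ∙-cancelʳ to +-cancelʳ)

  +1≤⇒< : ∀ {i j} → i + 1ℤ ≤ j → i < j
  +1≤⇒< {i} p = suc[i]≤j⇒i<j (≤-trans (≤-reflexive (+-comm 1ℤ i)) p)

  <⇒+1≤ : ∀ {i j} → i < j → i + 1ℤ ≤ j
  <⇒+1≤ {i} p = ≤-trans (≤-reflexive (+-comm i 1ℤ)) (i<j⇒suc[i]≤j p)

  <⇒≤-1 : ∀ {i j} → i < j → i ≤ j - 1ℤ
  <⇒≤-1 {i} {j} p = subst (i ≤_) (+-comm -1ℤ j) (i<j⇒i≤pred[j] p)

  i<i+1 : ∀ i → i < i + 1ℤ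
  i<i+1 i = +1≤⇒< ≤-refl

  i+1-1≡i : ∀ i → i + 1ℤ - 1ℤ ≡ i
  i+1-1≡i = lem
    where
    lem : ∀ i → i + 1ℤ + - 1ℤ ≡ i
    lem = solve-∀

  i-1+1≡i : ∀ i → i - 1ℤ + 1ℤ ≡ i
  i-1+1≡i = lem
    where
    lem : ∀ i → i + - 1ℤ + 1ℤ ≡ i
    lem = solve-∀

  +1-assoc : ∀ a k → a + 1ℤ + k ≡ a + (1ℤ + k)
  +1-assoc a = +-assoc a 1ℤ

  +-cancelʳ-≤ : ∀ c {a b} → a + c ≤ b + c → a ≤ b
  +-cancelʳ-≤ c {a} {b} p = subst₂ _≤_ (lem a c) (lem b c) (+-monoˡ-≤ (- c) p)
    where
    lem : ∀ a c → a + c + - c ≡ a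
    lem = solve-∀

  +-cancelʳ-< : ∀ c {a b} → a + c < b + c → a < b
  +-cancelʳ-< c {a} {b} p = subst₂ _<_ (lem a c) (lem b c) (+-monoˡ-< (- c) p)
    where
    lem : ∀ a c → a + c + - c ≡ a
    lem = solve-∀

  i≤+∣i∣ : ∀ {i} → i ≤ + ∣ i ∣
  i≤+∣i∣ {+ _}      = ≤-refl
  i≤+∣i∣ { -[1+ _ ]} = -≤+

  -- Sums over intervals of integers.

  sumFrom : (ℤ → ℤ) → ℤ → ℕ → ℤ
  sumFrom x a zero    = 0ℤ
  sumFrom x a (suc n) = x a + sumFrom x (a + 1ℤ) n

  sumFrom-cong : ∀ {x y} a n →
    (∀ k → k ℕ.< n → x (a + + k) ≡ y (a + + k)) → sumFrom x a n ≡ sumFrom y a n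
  sumFrom-cong a zero    e = refl
  sumFrom-cong {x} {y} a (suc n) e = cong₂ _+_
    (subst (λ b → x b ≡ y b) (+-identityʳ a) (e 0 (ℕ.s≤s ℕ.z≤n)))
    (sumFrom-cong (a + 1ℤ) n λ k k<n →
      subst (λ b → x b ≡ y b) (sym (+1-assoc a (+ k))) (e (suc k) (ℕ.s≤s k<n)))

  sumFrom-mono-≤ : ∀ {x y} → (∀ j → x j ≤ y j) → ∀ a n →
    sumFrom x a n ≤ sumFrom y a n
  sumFrom-mono-≤ x≤y a zero    = ≤-refl
  sumFrom-mono-≤ x≤y a (suc n) =
    +-mono-≤ (x≤y a) (sumFrom-mono-≤ x≤y (a + 1ℤ) n)

  sumFrom-mono-< : ∀ {x y} → (∀ j → x j ≤ y j) → ∀ a n k → k ℕ.< n →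
    x (a + + k) < y (a + + k) → sumFrom x a n < sumFrom y a n
  sumFrom-mono-< {x} {y} x≤y a (suc n) zero    _           p = +-mono-<-≤
    (subst (λ b → x b < y b) (+-identityʳ a) p)
    (sumFrom-mono-≤ x≤y (a + 1ℤ) n)
  sumFrom-mono-< {x} {y} x≤y a (suc n) (suc k) (ℕ.s≤s k<n) p = +-mono-≤-<
    (x≤y a)
    (sumFrom-mono-< x≤y (a + 1ℤ) n k k<n
      (subst (λ b → x b < y b) (sym (+1-assoc a (+ k))) p))

  sumFrom-snoc : ∀ x a n → sumFrom x a (suc n) ≡ sumFrom x a n + x (a + + n)
  sumFrom-snoc x a zero    = trans (+-comm (x a) 0ℤ)
    (cong (λ b → 0ℤ + x b) (sym (+-identityʳ a)))
  sumFrom-snoc x a (suc n) = begin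
    x a + sumFrom x (a + 1ℤ) (suc n)
      ≡⟨ cong (λ b → x a + b) (sumFrom-snoc x (a + 1ℤ) n) ⟩
    x a + (sumFrom x (a + 1ℤ) n + x (a + 1ℤ + + n))
      ≡⟨ +-assoc (x a) _ _ ⟨
    sumFrom x a (suc n) + x (a + 1ℤ + + n)
      ≡⟨ cong (λ b → sumFrom x a (suc n) + x b) (+1-assoc a (+ n)) ⟩
    sumFrom x a (suc n) + x (a + + suc n) ∎
    where open ≡-Reasoning

  sumFrom-id : ∀ n → sumFrom (λ j → j) 1ℤ n ≡ + (suc n C 2)
  sumFrom-id zero    = refl
  sumFrom-id (suc n) = begin
    sumFrom (λ j → j) 1ℤ (suc n)  ≡⟨ sumFrom-snoc (λ j → j) 1ℤ n ⟩
    sumFrom (λ j → j) 1ℤ n + + suc n  ≡⟨ cong (_+ + suc n) (sumFrom-id n) ⟩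
    + (suc n C 2) + + suc n       ≡⟨ +-comm (+ (suc n C 2)) (+ suc n) ⟩
    + (suc n ℕ.+ suc n C 2)
      ≡⟨ cong (λ k → + (k ℕ.+ suc n C 2)) (nC1≡n (suc n)) ⟨
    + (suc n C 1 ℕ.+ suc n C 2)   ≡⟨ cong +_ (nCk+nC[k+1]≡[n+1]C[k+1] (suc n) 1) ⟩
    + (suc (suc n) C 2) ∎
    where open ≡-Reasoning

  foldr-upTo≡sumFrom : ∀ x a n →
    foldr _+_ 0ℤ (map (λ k → x (a + + k)) (upTo n)) ≡ sumFrom x a n
  foldr-upTo≡sumFrom x a n =
    trans (cong (foldr _+_ 0ℤ) (List.map-upTo (λ k → x (a + + k)) n))
      (go a n _ λ _ → refl)
    where
    go : ∀ a n (h : ℕ → ℤ) → (∀ k → h k ≡ x (a + + k)) →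
         foldr _+_ 0ℤ (applyUpTo h n) ≡ sumFrom x a n
    go a zero    h e = refl
    go a (suc n) h e = cong₂ _+_ (trans (e 0) (cong x (+-identityʳ a)))
      (go (a + 1ℤ) n (λ k → h (suc k)) λ k →
        trans (e (suc k)) (cong x (sym (+1-assoc a (+ k)))))

module Fibers where

  open import Data.Bool.Base using (if_then_else_)
  open import Data.Empty using (⊥)
  open import Data.Fin.Base using (Fin; toℕ; fromℕ<)
  import Data.Fin.Properties as Fin
  open import Data.Integer.Base hiding (suc)
  open import Data.Integer.DivMod using (_%ℕ_; _/ℕ_; n%ℕd<d; a≡a%ℕn+[a/ℕn]*n)
  open import Data.Integer.Divisibility.Signed
  open import Data.Integer.Properties
  open import Data.Integer.Tactic.RingSolver using (solve-∀)
  open import Data.List.Base using ([]; _∷_; _++_; foldr; length)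
  open import Data.Nat.Base as ℕ using (ℕ; zero; suc)
  open import Data.Nat.Combinatorics using (_C_)
  import Data.Nat.Divisibility as ℕ
  import Data.Nat.Properties as ℕ
  open import Data.Product.Base using (_×_; _,_; proj₁; proj₂; ∃)
  open import Data.Product using (∃!)
  open import Data.Sum.Base using (_⊎_; inj₁; inj₂)
  open import Relation.Binary.PropositionalEquality
  open import Relation.Binary.Definitions using (tri<; tri≈; tri>)
  open import Relation.Nullary using (¬_; Dec; yes; no; contradiction)
  open import Relation.Nullary.Decidable using (⌊_⌋; ¬?; map′; _×-dec_)
  open IntegerSums

  module _ (N : ℕ) (3≤N : 3 ℕ.≤ N) where

    open Affine N 3≤N

    -- Congruence modulo N and skew periodic functions.

    1≤N : 1 ℕ.≤ N
    1≤N = ℕ.≤-trans (ℕ.s≤s ℕ.z≤n) 3≤N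

    ≅⇒shift : ∀ {a b} → a ≅ b → ∃ λ m → a ≡ b + m * + N
    ≅⇒shift {a} {b} (mod (divides m e)) =
      m , trans (lem a b) (cong (λ c → b + c) e)
      where
      lem : ∀ a b → a ≡ b + (a + - b)
      lem = solve-∀

    shift-≅ : ∀ a m → a + m * + N ≅ a
    shift-≅ a m = mod (divides m (lem a (m * + N)))
      where
      lem : ∀ a c → a + c + - a ≡ c
      lem = solve-∀

    shift+1 : ∀ a m → a + m * + N + 1ℤ ≡ a + 1ℤ + m * + N
    shift+1 a m = lem a (m * + N)
      where
      lem : ∀ a c → a + c + 1ℤ ≡ a + 1ℤ + c
      lem = solve-∀

    shift-1 : ∀ a m → a + m * + N - 1ℤ ≡ a - 1ℤ + m * + N
    shift-1 a m = lem a (m * + N)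
      where
      lem : ∀ a c → a + c + - 1ℤ ≡ a + - 1ℤ + c
      lem = solve-∀

    ≇-offset : ∀ {a} k → 1 ℕ.≤ k → k ℕ.< N → ¬ a + + k ≅ a
    ≇-offset {a} (suc k) _ k<N p = ℕ.>⇒∤ k<N
      (∣⇒∣ᵤ (subst (+ N ∣_) (lem a (+ suc k)) (_≅_.N∣a-b p)))
      where
      lem : ∀ a k → a + k + - a ≡ k
      lem = solve-∀

    residue : ∀ j → ∃ λ (i : Fin N) → ∃ λ m → j ≡ ι i + m * + N
    residue j = fromℕ< r<N , j /ℕ N , trans (a≡a%ℕn+[a/ℕn]*n j N)
      (cong (λ r → + r + (j /ℕ N) * + N) (sym (Fin.toℕ-fromℕ< r<N)))
      where
      instance _ = ℕ.>-nonZero 1≤N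
      r<N = n%ℕd<d j N

    -- Carries a point, by a multiple of N, to the right of `b`, where induction on naturals
    -- applies. Any m ≥ |b - a| serves, as N ≥ 1.
    reach : ∀ a b → ∃ λ m → ∃ λ k → a + + m * + N ≡ b + + k
    reach a b = m , ∣ a + + m * + N - b ∣ , trans (lem (a + + m * + N) b)
      (cong (λ c → b + c) (sym (0≤i⇒+∣i∣≡i (i≤j⇒0≤j-i b≤))))
      where
      m = ∣ b - a ∣
      lem : ∀ a b → a ≡ b + (a + - b)
      lem = solve-∀
      b≤ : b ≤ a + + m * + N
      b≤ = begin
        b              ≡⟨ lem b a ⟩
        a + (b - a)    ≤⟨ +-monoʳ-≤ a i≤+∣i∣ ⟩
        a + + m        ≤⟨ +-monoʳ-≤ a (+≤+ (ℕ.m≤m*n m N)) ⟩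
        a + + (m ℕ.* N) ≡⟨ cong (λ c → a + c) (pos-* m N) ⟩
        a + + m * + N  ∎
        where
        open ≤-Reasoning
        instance _ = ℕ.>-nonZero 1≤N

    skew-shift : ∀ h → SkewPeriodic h → ∀ j m → h (j + m * + N) ≡ h j + m * + N
    skew-shift h skew j (+ m) = go j m
      where
      lem : ∀ j m n → j + (1ℤ + m) * n ≡ j + m * n + n
      lem = solve-∀
      go : ∀ j m → h (j + + m * + N) ≡ h j + + m * + N
      go j zero    = trans (cong h (+-identityʳ j)) (sym (+-identityʳ (h j)))
      go j (suc m) = trans (cong h (lem j (+ m) (+ N)))
        (trans (skew (j + + m * + N)) (trans (cong (_+ + N) (go j m))
          (sym (lem (h j) (+ m) (+ N)))))
    skew-shift h skew j -[1+ m ] = begin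
      h j⁻                              ≡⟨ lem (h j⁻) (+ suc m) (+ N) ⟩
      h j⁻ + + suc m * + N + -mN        ≡⟨ cong (_+ -mN) (skew-shift h skew j⁻ (+ suc m)) ⟨
      h (j⁻ + + suc m * + N) + -mN      ≡⟨ cong (λ c → h c + -mN) (lem′ j (+ suc m) (+ N)) ⟩
      h j + -mN                         ∎
      where
      open ≡-Reasoning
      -mN = -[1+ m ] * + N
      j⁻ = j + -mN
      lem : ∀ a m n → a ≡ a + m * n + (- m) * n
      lem = solve-∀
      lem′ : ∀ a m n → a + (- m) * n + m * n ≡ a
      lem′ = solve-∀

    -- The action of a generator.

    data Position (i : Fin N) (j : ℤ) : Set where
      lower : j ≅ ι i → s i j ≡ j + 1ℤ → Position i j
      upper : j ≅ ι i + 1ℤ → s i j ≡ j - 1ℤ → Position i j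
      other : ¬ j ≅ ι i → ¬ j ≅ ι i + 1ℤ → s i j ≡ j → Position i j

    s-lower : ∀ i {j} → j ≅ ι i → s i j ≡ j + 1ℤ
    s-lower i {j} p with j ≅? ι i
    ... | yes _ = refl
    ... | no ¬p = contradiction p ¬p

    s-upper : ∀ i {j} → j ≅ ι i + 1ℤ → s i j ≡ j - 1ℤ
    s-upper i {j} q with j ≅? ι i | j ≅? ι i + 1ℤ
    ... | yes p | _     = contradiction (≅-trans (≅-sym p) q) ≇-suc
    ... | no _  | yes _ = refl
    ... | no _  | no ¬q = contradiction q ¬q

    s-other : ∀ i {j} → ¬ j ≅ ι i → ¬ j ≅ ι i + 1ℤ → s i j ≡ j
    s-other i {j} ¬p ¬q with j ≅? ι i | j ≅? ι i + 1ℤ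
    ... | yes p | _     = contradiction p ¬p
    ... | no _  | yes q = contradiction q ¬q
    ... | no _  | no _  = refl

    position : ∀ i j → Position i j
    position i j = go (j ≅? ι i) (j ≅? ι i + 1ℤ)
      where
      go : Dec (j ≅ ι i) → Dec (j ≅ ι i + 1ℤ) → Position i j
      go (yes p) _       = lower p (s-lower i p)
      go (no _)  (yes q) = upper q (s-upper i q)
      go (no ¬p) (no ¬q) = other ¬p ¬q (s-other i ¬p ¬q)

    s-involutive : ∀ i j → s i (s i j) ≡ j
    s-involutive i j with position i j
    ... | lower p e = trans (cong (s i) e)
          (trans (s-upper i (≅-+ 1ℤ p)) (i+1-1≡i j))
    ... | upper p e = trans (cong (s i) e)
          (trans (s-lower i (≅-pred p)) (i-1+1≡i j))
    ... | other _ _ e = trans (cong (s i) e) e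

    s-injective : ∀ i {j k} → s i j ≡ s i k → j ≡ k
    s-injective i {j} {k} e =
      trans (sym (s-involutive i j)) (trans (cong (s i) e) (s-involutive i k))

    s-shift : ∀ i j m → s i (j + m * + N) ≡ s i j + m * + N
    s-shift i j m with position i j
    ... | lower p e = trans (s-lower i (≅-trans (shift-≅ j m) p))
          (trans (shift+1 j m) (cong (_+ m * + N) (sym e)))
    ... | upper p e = trans (s-upper i (≅-trans (shift-≅ j m) p))
          (trans (shift-1 j m) (cong (_+ m * + N) (sym e)))
    ... | other ¬p ¬q e = trans
          (s-other i (λ p → ¬p (≅-trans (≅-sym (shift-≅ j m)) p))
                     (λ q → ¬q (≅-trans (≅-sym (shift-≅ j m)) q)))
          (cong (_+ m * + N) (sym e))

    s-cong-≅ : ∀ i {j k} → j ≅ k → s i j ≅ s i k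
    s-cong-≅ i {j} {k} p with ≅⇒shift p
    ... | m , refl = ≅-trans (≅-reflexive (s-shift i k m)) (shift-≅ (s i k) m)

    s-cancel-≅ : ∀ i {j k} → s i j ≅ s i k → j ≅ k
    s-cancel-≅ i {j} {k} p =
      subst₂ _≅_ (s-involutive i j) (s-involutive i k) (s-cong-≅ i p)

    j≤s[j]+1 : ∀ i j → j ≤ s i j + 1ℤ
    j≤s[j]+1 i j with position i j
    ... | lower _ e = subst (λ c → j ≤ c + 1ℤ) (sym e)
          (≤-trans (i≤i+j j 1ℤ) (i≤i+j (j + 1ℤ) 1ℤ))
    ... | upper _ e = subst (λ c → j ≤ c + 1ℤ) (sym e)
          (≤-reflexive (sym (i-1+1≡i j)))
    ... | other _ _ e = subst (λ c → j ≤ c + 1ℤ) (sym e) (i≤i+j j 1ℤ)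

    j≤s[j] : ∀ i {j} → ¬ j ≅ ι i + 1ℤ → j ≤ s i j
    j≤s[j] i {j} ¬q with position i j
    ... | lower _ e = subst (j ≤_) (sym e) (i≤i+j j 1ℤ)
    ... | upper q _ = contradiction q ¬q
    ... | other _ _ e = ≤-reflexive (sym e)

    s[j]≤j : ∀ i {j} → ¬ j ≅ ι i → s i j ≤ j
    s[j]≤j i {j} ¬p with position i j
    ... | lower p _ = contradiction p ¬p
    ... | upper _ e = subst (_≤ j) (sym e) (i-j≤i j 1ℤ)
    ... | other _ _ e = ≤-reflexive e

    -- `s i` raises only the points congruent to `ι i`, and moves no point by more than one, so only
    -- immediate neighbours can change order.
    s-inversion : ∀ i {a b} → a < b → s i b < s i a → a ≅ ι i × b ≡ a + 1ℤ
    s-inversion i {a} {b} a<b sb<sa = go (a ≅? ι i)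
      where
      go : Dec (a ≅ ι i) → a ≅ ι i × b ≡ a + 1ℤ
      go (no ¬p) = contradiction
        (<-≤-trans sb<sa (s[j]≤j i ¬p))
        (≤⇒≯ (+-cancelʳ-≤ 1ℤ (≤-trans (<⇒+1≤ a<b) (j≤s[j]+1 i b))))
      go (yes p) = p , ≤-antisym
        (≤-trans (j≤s[j]+1 i b) (subst (s i b + 1ℤ ≤_) (s-lower i p) (<⇒+1≤ sb<sa)))
        (<⇒+1≤ a<b)

    -- Words as permutations and the exchange property.

    ·-shift : ∀ u j m → (j + m * + N) · u ≡ j · u + m * + N
    ·-shift []      j m = refl
    ·-shift (i ∷ u) j m = trans (cong (_· u) (s-shift i j m)) (·-shift u (s i j) m)

    ·-injective : ∀ u {j k} → j · u ≡ k · u → j ≡ k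
    ·-injective []      e = e
    ·-injective (i ∷ u) e = s-injective i (·-injective u e)

    ·-surjective : ∀ u k → ∃ λ j → j · u ≡ k
    ·-surjective []      k = k , refl
    ·-surjective (i ∷ u) k with ·-surjective u k
    ... | j , e = s i j , trans (cong (_· u) (s-involutive i j)) e

    ·-shift-< : ∀ u {a b} → a · u < b · u → ∀ m →
                (a + m * + N) · u < (b + m * + N) · u
    ·-shift-< u {a} {b} p m = subst₂ _<_ (sym (·-shift u a m)) (sym (·-shift u b m))
      (+-monoˡ-< (m * + N) p)

    -- `v′` acts as `v` preceded by the affine reflection, which exchanges the translates
    -- `a + m * + N` and `b + m * + N` for all m at once.
    record Transposes (a b : ℤ) (v v′ : Word) : Set where
      field
        atˡ  : ∀ m → (a + m * + N) · v′ ≡ (b + m * + N) · v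
        atʳ  : ∀ m → (b + m * + N) · v′ ≡ (a + m * + N) · v
        away : ∀ {j} → ¬ j ≅ a → ¬ j ≅ b → j · v′ ≡ j · v

    -- The values of a and b are exchanged by deleting a letter at which they
    -- change their relative order.
    exchange : ∀ v {a b} → a < b → b · v < a · v →
      ∃ λ v′ → length v′ ℕ.< length v × Transposes a b v v′
    exchange []      a<b b<a = contradiction a<b (<-asym b<a)
    exchange (i ∷ u) {a} {b} a<b vb<va with <-cmp (s i a) (s i b)
    ... | tri≈ _ e _ = contradiction (s-injective i e) (<⇒≢ a<b)
    -- The first letter keeps the order of the pair, so it is retained and the crossing is sought
    -- for the images `s i a` and `s i b`.
    ... | tri< sa<sb _ _ with exchange u sa<sb vb<va
    ...   | u′ , shorter , T = i ∷ u′ , ℕ.s≤s shorter , record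
      { atˡ  = λ m → trans (cong (_· u′) (s-shift i a m))
                 (trans (T.atˡ m) (cong (_· u) (sym (s-shift i b m))))
      ; atʳ  = λ m → trans (cong (_· u′) (s-shift i b m))
                 (trans (T.atʳ m) (cong (_· u) (sym (s-shift i a m))))
      ; away = λ ¬a ¬b → T.away (λ p → ¬a (s-cancel-≅ i p)) (λ p → ¬b (s-cancel-≅ i p))
      }
      where module T = Transposes T
    -- The first letter is itself the crossing.
    exchange (i ∷ u) {a} {b} a<b vb<va | tri> _ _ sb<sa with s-inversion i a<b sb<sa
    ... | p , refl = u , ℕ.≤-refl , record
      { atˡ  = λ m → cong (_· u) (sym (trans (s-shift i b m) (cong (_+ m * + N)
                 (trans (s-upper i (≅-+ 1ℤ p)) (i+1-1≡i a)))))
      ; atʳ  = λ m → cong (_· u) (sym (trans (s-shift i a m) (cong (_+ m * + N)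
                 (s-lower i p))))
      ; away = λ ¬a ¬b → cong (_· u) (sym (s-other i
                 (λ q → ¬a (≅-trans q (≅-sym p)))
                 (λ q → ¬b (≅-trans q (≅-sym (≅-+ 1ℤ p))))))
      }

    -- The points `ι i` and `ι i + 1ℤ` cross inside `u`. Deleting the letter where they do leaves a
    -- word that acts as `i ∷ u`, because the reflection exchanging this pair is `s i`.
    cons-descent : ∀ i u → (ι i + 1ℤ) · u < ι i · u →
      ∃ λ v → length v ℕ.< length u × (∀ j → j · v ≡ j · (i ∷ u))
    cons-descent i u d with exchange u (i<i+1 (ι i)) d
    ... | v , shorter , T = v , shorter , same
      where
      module T = Transposes T
      same : ∀ j → j · v ≡ s i j · u
      same j with position i j
      ... | other ¬p ¬q e = trans (T.away ¬p ¬q) (cong (_· u) (sym e))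
      ... | lower p e with ≅⇒shift p
      ...   | m , refl = trans (T.atˡ m)
              (cong (_· u) (sym (trans e (shift+1 (ι i) m))))
      same j | upper q e with ≅⇒shift q
      ...   | m , refl = trans (T.atʳ m) (cong (_· u) (sym (trans e
              (trans (shift-1 (ι i + 1ℤ) m) (cong (_+ m * + N) (i+1-1≡i (ι i)))))))

    -- Suffix minima and compatible words.

    record SuffixMin (g x : ℤ → ℤ) : Set where
      field
        bound    : ∀ {j k} → j ≤ k → g j ≤ x k
        attained : ∀ j → ∃ λ k → j ≤ k × x k ≡ g j

    Compatible : Word → Set
    Compatible u = SuffixMin (app (P u)) (_· u)

    suffixMin-resp : ∀ {g g′ x x′} → (∀ j → g j ≡ g′ j) → (∀ j → x j ≡ x′ j) →
      SuffixMin g x → SuffixMin g′ x′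
    suffixMin-resp g≡ x≡ S = record
      { bound    = λ {j} {k} j≤k → subst₂ _≤_ (g≡ j) (x≡ k) (S.bound j≤k)
      ; attained = λ j → let k , j≤k , e = S.attained j in
          k , j≤k , trans (sym (x≡ k)) (trans e (g≡ j))
      }
      where module S = SuffixMin S

    compatible-[] : Compatible []
    compatible-[] = record { bound = λ j≤k → j≤k ; attained = λ j → j , ≤-refl , refl }

    -- Where `s i` lowers a point, `f i` lowers it equally; a strictly smaller `j` leaves room for a
    -- drop of one.
    f≤s : ∀ i {j k} → j ≤ k → f-fun i j ≤ s i k
    f≤s i {j} {k} j≤k = go (k ≅? ι i + 1ℤ) (j ≟ k)
      where
      go : Dec (k ≅ ι i + 1ℤ) → Dec (j ≡ k) → f-fun i j ≤ s i k
      go (no ¬q) _ = ≤-trans (regressive (f i) j) (≤-trans j≤k (j≤s[j] i ¬q))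
      go (yes q) (yes refl) = ≤-reflexive (trans (f-hit i q) (sym (s-upper i q)))
      go (yes q) (no j≢k) = ≤-trans (regressive (f i) j)
        (subst (j ≤_) (sym (s-upper i q)) (<⇒≤-1 (≤∧≢⇒< j≤k j≢k)))

    ascent-at : ∀ i u {j} → ι i · u < (ι i + 1ℤ) · u → j ≅ ι i + 1ℤ →
                (j - 1ℤ) · u < j · u
    ascent-at i u a q with ≅⇒shift q
    ... | m , refl = subst (λ c → c · u < (ι i + 1ℤ + m * + N) · u)
          (sym (trans (shift-1 (ι i + 1ℤ) m) (cong (_+ m * + N) (i+1-1≡i (ι i)))))
          (·-shift-< u a m)

    descent-at : ∀ i u {j} → (ι i + 1ℤ) · u < ι i · u → j ≅ ι i + 1ℤ →
                 j · u < (j - 1ℤ) · u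
    descent-at i u a q with ≅⇒shift q
    ... | m , refl = subst (λ c → (ι i + 1ℤ + m * + N) · u < c · u)
          (sym (trans (shift-1 (ι i + 1ℤ) m) (cong (_+ m * + N) (i+1-1≡i (ι i)))))
          (·-shift-< u a m)

    -- `s i` maps the ray k ≥ j to itself unless `j` is congruent to `ι i + 1ℤ`. Then it gives the
    -- ray from `j - 1ℤ` with `j` removed, and by the ascent the minimum over the full ray is not at
    -- `j`. In both cases the ray in question starts at `f-fun i j`.
    compatible-∷ : ∀ i u → ι i · u < (ι i + 1ℤ) · u → Compatible u → Compatible (i ∷ u)
    compatible-∷ i u asc S = record
      { bound    = λ j≤k → S.bound (f≤s i j≤k)
      ; attained = attained
      }
      where
      module S = SuffixMin S
      g = app (P u)

      attained : ∀ j → ∃ λ k → j ≤ k × s i k · u ≡ g (f-fun i j)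
      attained j with S.attained (f-fun i j)
      ... | k , f≤k , e = s i k , j≤ (j ≅? ι i + 1ℤ) , trans (cong (_· u) (s-involutive i k)) e
        where
        beyond : j < k → j ≤ s i k
        beyond j<k = +-cancelʳ-≤ 1ℤ (≤-trans (<⇒+1≤ j<k) (j≤s[j]+1 i k))

        j≤ : Dec (j ≅ ι i + 1ℤ) → j ≤ s i k
        j≤ (no ¬q) with <-cmp j k
        ... | tri< j<k _ _  = beyond j<k
        ... | tri≈ _ refl _ = j≤s[j] i ¬q
        ... | tri> _ _ k<j  = contradiction k<j
              (≤⇒≯ (subst (_≤ k) (f-miss i ¬q) f≤k))
        j≤ (yes q) with <-cmp j k
        ... | tri< j<k _ _  = beyond j<k
        ... | tri≈ _ refl _ = contradiction (ascent-at i u asc q)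
              (≤⇒≯ (subst (_≤ (j - 1ℤ) · u) (trans (cong g (sym (f-hit i q))) (sym e))
                (S.bound ≤-refl)))
        ... | tri> _ _ k<j  = ≤-reflexive (trans (sym (i-1+1≡i j))
              (trans (sym (s-lower i (≅-pred q))) (cong (s i) (sym k≡))))
          where
          k≡ : k ≡ j - 1ℤ
          k≡ = ≤-antisym (<⇒≤-1 k<j) (subst (_≤ k) (f-hit i q) f≤k)

    -- A descent is absorbed: a position `j - 1ℤ` congruent to `ι i` is followed by a smaller value,
    -- so it is no suffix minimum and `P u` already agrees at `j - 1ℤ` and `j`.
    P-∷-descent : ∀ i u → (ι i + 1ℤ) · u < ι i · u → Compatible u →
                  ∀ j → app (P (i ∷ u)) j ≡ app (P u) j
    P-∷-descent i u d S j = go (j ≅? ι i + 1ℤ)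
      where
      module S = SuffixMin S
      g = app (P u)

      go : Dec (j ≅ ι i + 1ℤ) → g (f-fun i j) ≡ g j
      go (no ¬q) = cong g (f-miss i ¬q)
      go (yes q) = trans (cong g (f-hit i q))
        (≤-antisym (orderPreserving (P u) (i-j≤i j 1ℤ)) (g≤ (S.attained (j - 1ℤ))))
        where
        g≤ : (∃ λ k → j - 1ℤ ≤ k × k · u ≡ g (j - 1ℤ)) → g j ≤ g (j - 1ℤ)
        g≤ (k , j-1≤k , e) with j - 1ℤ ≟ k
        ... | yes refl = contradiction (descent-at i u d q)
              (≤⇒≯ (subst (_≤ j · u) (sym e) (S.bound (i-j≤i j 1ℤ))))
        ... | no j-1≢k = subst (g j ≤_) e (S.bound (subst (_≤ k) (i-1+1≡i j)
              (<⇒+1≤ (≤∧≢⇒< j-1≤k j-1≢k))))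

    suffixMin-≤ : ∀ {g g′ x} → SuffixMin g x → SuffixMin g′ x → ∀ j → g j ≤ g′ j
    suffixMin-≤ {g} S S′ j = let k , j≤k , e = SuffixMin.attained S′ j in
      subst (g j ≤_) e (SuffixMin.bound S j≤k)

    suffixMin-unique : ∀ {g g′ x} → SuffixMin g x → SuffixMin g′ x → ∀ j → g j ≡ g′ j
    suffixMin-unique S S′ j = ≤-antisym (suffixMin-≤ S S′ j) (suffixMin-≤ S′ S j)

    -- The two larger values of a 321 pattern are not suffix minima, so
    -- exchanging them does not affect the suffix minima.
    suffixMin-transpose : ∀ {g a b c v v′} → a < b → b < c →
      b · v < a · v → c · v < b · v → Transposes a b v v′ →
      SuffixMin g (_· v) → SuffixMin g (_· v′)
    suffixMin-transpose {g} {a} {b} {c} {v} {v′} a<b b<c vb<va vc<vb T S = record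
      { bound    = λ {j} {k} j≤k → bound j≤k (k ≅? a) (k ≅? b)
      ; attained = λ j → let k , j≤k , e = S.attained j in attained j≤k e (k ≅? a) (k ≅? b)
      }
      where
      module S = SuffixMin S
      module T = Transposes T

      bound : ∀ {j k} → j ≤ k → Dec (k ≅ a) → Dec (k ≅ b) → g j ≤ k · v′
      bound {j} {k} j≤k (no ¬a) (no ¬b) = subst (g j ≤_) (sym (T.away ¬a ¬b)) (S.bound j≤k)
      bound {j} j≤k (yes p) _ with ≅⇒shift p
      ... | m , refl = subst (g j ≤_) (sym (T.atˡ m))
            (S.bound (≤-trans j≤k (<⇒≤ (+-monoˡ-< (m * + N) a<b))))
      -- Position b now carries the value of a, whose own position may lie left of `j`; the bound
      -- comes from the entry at c.
      bound {j} j≤k (no _) (yes q) with ≅⇒shift q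
      ... | m , refl = subst (g j ≤_) (sym (T.atʳ m))
            (<⇒≤ (≤-<-trans (S.bound (≤-trans j≤k (<⇒≤ (+-monoˡ-< (m * + N) b<c))))
              (·-shift-< v (<-trans vc<vb vb<va) m)))

      attained : ∀ {j k} → j ≤ k → k · v ≡ g j → Dec (k ≅ a) → Dec (k ≅ b) →
                 ∃ λ k → j ≤ k × k · v′ ≡ g j
      attained {k = k} j≤k e (no ¬a) (no ¬b) = k , j≤k , trans (T.away ¬a ¬b) e
      attained j≤k e (yes p) _ with ≅⇒shift p
      ... | m , refl = contradiction (·-shift-< v vb<va m)
            (≤⇒≯ (subst (_≤ (b + m * + N) · v) (sym e)
              (S.bound (≤-trans j≤k (<⇒≤ (+-monoˡ-< (m * + N) a<b))))))
      attained j≤k e (no _) (yes q) with ≅⇒shift q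
      ... | m , refl = contradiction (·-shift-< v vc<vb m)
            (≤⇒≯ (subst (_≤ (c + m * + N) · v) (sym e)
              (S.bound (≤-trans j≤k (<⇒≤ (+-monoˡ-< (m * + N) b<c))))))

    ascent⊎descent : ∀ i u →
      ι i · u < (ι i + 1ℤ) · u ⊎ (ι i + 1ℤ) · u < ι i · u
    ascent⊎descent i u with <-cmp (ι i · u) ((ι i + 1ℤ) · u)
    ... | tri< a _ _ = inj₁ a
    ... | tri≈ _ e _ = contradiction (·-injective u e) (<⇒≢ (i<i+1 (ι i)))
    ... | tri> _ _ d = inj₂ d

    -- Drops each letter that is a descent for the tail already treated. This may change the
    -- permutation.
    compatible-sameP : ∀ u → ∃ λ v →
      length v ℕ.≤ length u × P v ≈F P u × Compatible v
    compatible-sameP []      = [] , ℕ.z≤n , (λ _ → refl) , compatible-[]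
    compatible-sameP (i ∷ u) with compatible-sameP u
    ... | v , v≤u , e , S with ascent⊎descent i v
    ...   | inj₁ a = i ∷ v , ℕ.s≤s v≤u , (λ j → e (f-fun i j)) , compatible-∷ i v a S
    ...   | inj₂ d = v , ℕ.m≤n⇒m≤1+n v≤u
            , (λ j → trans (sym (P-∷-descent i v d S j)) (e (f-fun i j))) , S

    -- A descent is cancelled by `cons-descent` instead of dropped. The word obtained comes without
    -- compatibility and is treated anew, so the recursion runs on a length bound.
    compatible-samePerm : ∀ u → ∃ λ v →
      length v ℕ.≤ length u × (∀ j → j · v ≡ j · u) × Compatible v
    compatible-samePerm u = go (length u) u ℕ.≤-refl
      where
      go : ∀ n u → length u ℕ.≤ n → ∃ λ v →
        length v ℕ.≤ length u × (∀ j → j · v ≡ j · u) × Compatible v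
      go n       []      _   = [] , ℕ.z≤n , (λ _ → refl) , compatible-[]
      go (suc n) (i ∷ u) (ℕ.s≤s u≤n) with go n u u≤n
      ... | v , v≤u , e , S with ascent⊎descent i v
      ...   | inj₁ a = i ∷ v , ℕ.s≤s v≤u , (λ j → e (s i j)) , compatible-∷ i v a S
      ...   | inj₂ d with cons-descent i v d
      ...     | v₁ , v₁<v , e₁ with go n v₁ (ℕ.≤-trans (ℕ.<⇒≤ v₁<v) (ℕ.≤-trans v≤u u≤n))
      ...       | v₂ , v₂≤v₁ , e₂ , S₂ =
                v₂ , ℕ.m≤n⇒m≤1+n (ℕ.≤-trans v₂≤v₁ (ℕ.≤-trans (ℕ.<⇒≤ v₁<v) v≤u))
                , (λ j → trans (e₂ j) (trans (e₁ j) (e (s i j)))) , S₂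

    Reduced : Word → Set
    Reduced u = ∀ v → (∀ j → j · v ≡ j · u) → length u ℕ.≤ length v

    -- Tails of reduced words are reduced, and a descent at the first letter would let
    -- `cons-descent` shorten the word.
    reduced⇒compatible : ∀ u → Reduced u → Compatible u
    reduced⇒compatible []      _ = compatible-[]
    reduced⇒compatible (i ∷ u) R with ascent⊎descent i u
    ... | inj₁ a = compatible-∷ i u a
          (reduced⇒compatible u λ v e → ℕ.s≤s⁻¹ (R (i ∷ v) (λ j → e (s i j))))
    ... | inj₂ d with cons-descent i u d
    ...   | v , v<u , e = contradiction (R v e) (ℕ.<⇒≱ (ℕ.m<n⇒m<1+n v<u))

    -- Window sums.

    ·-skew : ∀ u → SkewPeriodic (_· u)
    ·-skew u j = subst (λ n → (j + n) · u ≡ j · u + n) (*-identityˡ (+ N)) (·-shift u j 1ℤ)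

    windowSum≡sumFrom : ∀ x → windowSum x ≡ sumFrom x 1ℤ N
    windowSum≡sumFrom x = foldr-upTo≡sumFrom x 1ℤ N

    windowSum-mono-≤ : ∀ {x y} → (∀ j → x j ≤ y j) → windowSum x ≤ windowSum y
    windowSum-mono-≤ {x} {y} x≤y =
      subst₂ _≤_ (sym (windowSum≡sumFrom x)) (sym (windowSum≡sumFrom y))
        (sumFrom-mono-≤ x≤y 1ℤ N)

    -- Periodicity moves the strict inequality into the window. The residue is taken of `j - 1ℤ`
    -- because the window starts at 1 and the representatives at 0.
    windowSum-mono-< : ∀ {x y} → SkewPeriodic x → SkewPeriodic y →
      (∀ j → x j ≤ y j) → ∀ {j} → x j < y j → windowSum x < windowSum y
    windowSum-mono-< {x} {y} skew-x skew-y x≤y {j} xj<yj with residue (j - 1ℤ)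
    ... | i , m , e = subst₂ _<_ (sym (windowSum≡sumFrom x)) (sym (windowSum≡sumFrom y))
          (sumFrom-mono-< x≤y 1ℤ N (toℕ i) (Fin.toℕ<n i)
            (+-cancelʳ-< (m * + N) (subst₂ _<_ (at x skew-x) (at y skew-y) xj<yj)))
      where
      j≡ : j ≡ 1ℤ + ι i + m * + N
      j≡ = trans (sym (i-1+1≡i j)) (trans (cong (_+ 1ℤ) e)
        (trans (+-comm (ι i + m * + N) 1ℤ) (sym (+-assoc 1ℤ (ι i) (m * + N)))))
      at : ∀ x → SkewPeriodic x → x j ≡ x (1ℤ + ι i) + m * + N
      at x skew = trans (cong x j≡) (skew-shift x skew (1ℤ + ι i) m)

    -- Sliding the window by one trades `x a` for `x (a + + N)`, which is larger by N.
    sumFrom-+1 : ∀ {x} → SkewPeriodic x → ∀ a →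
      sumFrom x (a + 1ℤ) N ≡ sumFrom x a N + + N
    sumFrom-+1 {x} skew a = +-cancelˡ (x a) _ _ (begin
      x a + sumFrom x (a + 1ℤ) N     ≡⟨ sumFrom-snoc x a N ⟩
      sumFrom x a N + x (a + + N)    ≡⟨ cong (λ c → sumFrom x a N + c) (skew a) ⟩
      sumFrom x a N + (x a + + N)    ≡⟨ lem (sumFrom x a N) (x a) (+ N) ⟩
      x a + (sumFrom x a N + + N)    ∎)
      where
      open ≡-Reasoning
      lem : ∀ s a n → s + (a + n) ≡ a + (s + n)
      lem = solve-∀

    sumFrom-+ : ∀ {x} → SkewPeriodic x → ∀ n →
      sumFrom x (+ n) N ≡ sumFrom x 0ℤ N + + n * + N
    sumFrom-+ skew zero    = sym (+-identityʳ _)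
    sumFrom-+ {x} skew (suc n) = begin
      sumFrom x (+ suc n) N           ≡⟨ cong (λ a → sumFrom x a N) (+-comm 1ℤ (+ n)) ⟩
      sumFrom x (+ n + 1ℤ) N          ≡⟨ sumFrom-+1 skew (+ n) ⟩
      sumFrom x (+ n) N + + N         ≡⟨ cong (_+ + N) (sumFrom-+ skew n) ⟩
      sumFrom x 0ℤ N + + n * + N + + N ≡⟨ lem (sumFrom x 0ℤ N) (+ n) (+ N) ⟩
      sumFrom x 0ℤ N + + suc n * + N  ∎
      where
      open ≡-Reasoning
      lem : ∀ s m n → s + m * n + n ≡ s + (1ℤ + m) * n
      lem = solve-∀

    -- The window starts at `ι i` so that its first two points are the ones swapped. In the window
    -- from 1 to N, the generator with `ι i ≡ 0ℤ` would carry points across the boundary.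
    sumFrom-s : ∀ x i → sumFrom (λ j → x (s i j)) (ι i) N ≡ sumFrom x (ι i) N
    sumFrom-s x i = go N (ℕ.≤-trans (ℕ.s≤s (ℕ.s≤s ℕ.z≤n)) 3≤N) ℕ.≤-refl
      where
      open ≡-Reasoning
      a = ι i
      lem : ∀ p q r → p + (q + r) ≡ q + (p + r)
      lem = solve-∀
      assoc₂ : ∀ a k → a + 1ℤ + 1ℤ + k ≡ a + (1ℤ + (1ℤ + k))
      assoc₂ = solve-∀
      assoc₁ : ∀ a k → a + 1ℤ + 1ℤ + k ≡ a + 1ℤ + (1ℤ + k)
      assoc₁ = solve-∀

      -- N is generalised to M ≤ N so that the first two summands can be split off.
      go : ∀ M → 2 ℕ.≤ M → M ℕ.≤ N → sumFrom (λ j → x (s i j)) a M ≡ sumFrom x a M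
      go (suc zero) (ℕ.s≤s ()) _
      go (suc (suc m)) _ M≤N = begin
        x (s i a) + (x (s i (a + 1ℤ)) + sumFrom (λ j → x (s i j)) (a + 1ℤ + 1ℤ) m)
          ≡⟨ cong₂ (λ p q → p + q)
               (cong x (s-lower i (≅-reflexive refl)))
               (cong₂ _+_
                 (cong x (trans (s-upper i (≅-reflexive refl)) (i+1-1≡i a)))
                 (sumFrom-cong (a + 1ℤ + 1ℤ) m λ k k<m → cong x (fixed k k<m))) ⟩
        x (a + 1ℤ) + (x a + sumFrom x (a + 1ℤ + 1ℤ) m)
          ≡⟨ lem (x (a + 1ℤ)) (x a) _ ⟩
        x a + (x (a + 1ℤ) + sumFrom x (a + 1ℤ + 1ℤ) m) ∎
        where
        fixed : ∀ k → k ℕ.< m → s i (a + 1ℤ + 1ℤ + + k) ≡ a + 1ℤ + 1ℤ + + k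
        fixed k k<m = s-other i
          (λ p → ≇-offset (2 ℕ.+ k) (ℕ.s≤s ℕ.z≤n) (ℕ.≤-trans (ℕ.s≤s (ℕ.s≤s k<m)) M≤N)
            (subst (_≅ a) (assoc₂ a (+ k)) p))
          (λ q → ≇-offset (1 ℕ.+ k) (ℕ.s≤s ℕ.z≤n)
            (ℕ.≤-trans (ℕ.s≤s k<m) (ℕ.≤-trans (ℕ.n≤1+n _) M≤N))
            (subst (_≅ a + 1ℤ) (assoc₁ a (+ k)) q))

    windowSum-· : ∀ u → windowSum (_· u) ≡ + (suc N C 2)
    windowSum-· []      = trans (windowSum≡sumFrom (λ j → j)) (sumFrom-id N)
    windowSum-· (i ∷ u) = begin
      windowSum (_· (i ∷ u))             ≡⟨ windowSum≡sumFrom (_· (i ∷ u)) ⟩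
      sumFrom (_· (i ∷ u)) 1ℤ N          ≡⟨ sumFrom-+ (·-skew (i ∷ u)) 1 ⟩
      sumFrom (_· (i ∷ u)) 0ℤ N + 1ℤ * + N ≡⟨ cong (_+ 1ℤ * + N) at-0 ⟩
      sumFrom (_· u) 0ℤ N + 1ℤ * + N     ≡⟨ sumFrom-+ (·-skew u) 1 ⟨
      sumFrom (_· u) 1ℤ N                ≡⟨ windowSum≡sumFrom (_· u) ⟨
      windowSum (_· u)                   ≡⟨ windowSum-· u ⟩
      + (suc N C 2)                      ∎
      where
      open ≡-Reasoning
      -- Sliding the window from 0 to `ι i` adds the same multiple of N to both sums, and there the
      -- generator only permutes the summands.
      at-0 : sumFrom (_· (i ∷ u)) 0ℤ N ≡ sumFrom (_· u) 0ℤ N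
      at-0 = +-cancelʳ (ι i * + N) _ _
        (trans (sym (sumFrom-+ (·-skew (i ∷ u)) (toℕ i)))
          (trans (sumFrom-s (_· u) i) (sumFrom-+ (·-skew u) (toℕ i))))

    -- Words as elements of a fiber.

    affinePerm : Word → AffinePerm
    affinePerm u = record
      { fun       = _· u
      ; bijective = ·-injective u , λ k → let j , e = ·-surjective u k in
          j , λ z≡j → trans (cong (_· u) z≡j) e
      ; periodic  = ·-skew u
      ; window    = windowSum-· u
      }

    foldr-π : ∀ u → foldr (λ i → π i H₀.∙_) H₀.ε u ≡ u
    foldr-π []      = refl
    foldr-π (i ∷ u) = cong (i ∷_) (foldr-π u)

    inFiber⇒suffixMin : ∀ g w → w InFiberOver g → SuffixMin (app g) (fun w)
    inFiber⇒suffixMin g w (h , (u , (u-for-w , shortest) , h≈u) , Ph≈g) =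
      suffixMin-resp
        (λ j → trans (sym (P-cong (subst (h ≈H_) (foldr-π u) h≈u) j)) (Ph≈g j))
        u-for-w
        (reduced⇒compatible u λ v e → shortest v λ j → trans (e j) (u-for-w j))

    reduced⇒inFiber : ∀ g u → P u ≈F g → Reduced u → affinePerm u InFiberOver g
    reduced⇒inFiber g u Pu≈g R =
      u , (u , ((λ _ → refl) , R) , subst (u ≈H_) (sym (foldr-π u)) ≈H-refl) , Pu≈g

    -- Surjectivity of P

    Gap : NDPF → ℤ → Set
    Gap g j = app g j + 1ℤ < app g (j + 1ℤ)

    gap-shift : ∀ g {j} m → Gap g j → Gap g (j + m * + N)
    gap-shift g {j} m gap = subst₂ _<_
      (sym (trans (cong (_+ 1ℤ) (at j)) (shift+1 (app g j) m)))
      (sym (trans (cong (app g) (shift+1 j m)) (at (j + 1ℤ))))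
      (+-monoˡ-< (m * + N) gap)
      where
      at : ∀ j → app g (j + m * + N) ≡ app g j + m * + N
      at j = skew-shift (app g) (skewPeriodic g) j m

    -- The image of `f i` misses the class of `ι i + 1ℤ`, so `f i` can be split off on the right
    -- only from a function that skips this class.
    gap-skips : ∀ g {j} → Gap g j → ∀ i → app g i ≢ app g j + 1ℤ
    gap-skips g {j} gap i e with <-cmp i (j + 1ℤ)
    ... | tri< i<j+1 _ _ = contradiction (i<i+1 (app g j))
          (≤⇒≯ (subst (_≤ app g j) e (orderPreserving g
            (subst (i ≤_) (i+1-1≡i j) (<⇒≤-1 i<j+1)))))
    ... | tri≈ _ refl _  = <⇒≢ gap (sym e)
    ... | tri> _ _ j+1<i = contradiction gap
          (≤⇒≯ (subst (app g (j + 1ℤ) ≤_) e (orderPreserving g (<⇒≤ j+1<i))))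

    -- Given a value k = g j₀ that is followed by a gap, raising to k + 1 all
    -- occurrences of k except a fixed point is undone by a generator.
    module Raise (g : NDPF) (j₀ : ℤ) (gap : Gap g j₀) where

      k : ℤ
      k = app g j₀

      -- The whole congruence class of `k` is raised, to keep skew periodicity. Raising a fixed
      -- point would violate regressivity.
      Raised : ℤ → Set
      Raised j = app g j ≅ k × app g j ≢ j

      raised? : ∀ j → Dec (Raised j)
      raised? j = (app g j ≅? k) ×-dec ¬? (app g j ≟ j)

      raise : ℤ → ℤ
      raise j = if ⌊ raised? j ⌋ then app g j + 1ℤ else app g j

      raise-yes : ∀ {j} → Raised j → raise j ≡ app g j + 1ℤ
      raise-yes {j} r with raised? j
      ... | yes _ = refl
      ... | no ¬r = contradiction r ¬r

      raise-no : ∀ {j} → ¬ Raised j → raise j ≡ app g j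
      raise-no {j} ¬r with raised? j
      ... | yes r = contradiction r ¬r
      ... | no _  = refl

      g≤raise : ∀ j → app g j ≤ raise j
      g≤raise j with raised? j
      ... | yes _ = i≤i+j (app g j) 1ℤ
      ... | no _  = ≤-refl

      -- A fixed point cannot be followed by a gap, since the next value would exceed its argument.
      -- Hence raising does change the function.
      j₀-raised : Raised j₀
      j₀-raised = ≅-reflexive refl , λ e →
        contradiction gap (≤⇒≯ (subst (λ c → app g (j₀ + 1ℤ) ≤ c + 1ℤ) (sym e)
          (regressive g (j₀ + 1ℤ))))

      reg : ∀ j → raise j ≤ j
      reg j with raised? j
      ... | yes (_ , ≢j) = <⇒+1≤ (≤∧≢⇒< (regressive g j) ≢j)
      ... | no _         = regressive g j

      mono : ∀ {i j} → i ≤ j → raise i ≤ raise j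
      mono {i} {j} i≤j = go (raised? i) (app g i ≟ app g j)
        where
        go : Dec (Raised i) → Dec (app g i ≡ app g j) → raise i ≤ raise j
        go (no ¬r) _ = subst (_≤ raise j) (sym (raise-no ¬r))
          (≤-trans (orderPreserving g i≤j) (g≤raise j))
        go (yes r) (no gi≢gj) = subst (_≤ raise j) (sym (raise-yes r))
          (≤-trans (<⇒+1≤ (≤∧≢⇒< (orderPreserving g i≤j) gi≢gj)) (g≤raise j))
        -- A fixed point is the left end of its level set: were `j` fixed, then i ≤ j = g i ≤ i
        -- would make `i` fixed too.
        go (yes r) (yes gi≡gj) = ≤-reflexive (trans (raise-yes r)
          (trans (cong (_+ 1ℤ) gi≡gj) (sym (raise-yes
            ( subst (_≅ k) gi≡gj (proj₁ r)
            , λ gj≡j → proj₂ r (≤-antisym (regressive g i)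
                (≤-trans i≤j (≤-reflexive (trans (sym gj≡j) (sym gi≡gj))))))))))

      skew : SkewPeriodic raise
      skew j = go (raised? j)
        where
        lem : ∀ a n → a + n + 1ℤ ≡ a + 1ℤ + n
        lem = solve-∀
        e = skewPeriodic g j
        go : Dec (Raised j) → raise (j + + N) ≡ raise j + + N
        go (yes r) = trans
          (raise-yes
            ( subst (_≅ k) (sym e) (≅-trans (≅-N (app g j)) (proj₁ r))
            , λ fixed → proj₂ r (+-cancelʳ (+ N) _ _ (trans (sym e) fixed))))
          (trans (cong (_+ 1ℤ) e) (trans (lem (app g j) (+ N))
            (cong (_+ + N) (sym (raise-yes r)))))
        go (no ¬r) = trans
          (raise-no λ r → ¬r
            ( ≅-trans (≅-sym (≅-N (app g j))) (subst (_≅ k) e (proj₁ r))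
            , λ fixed → proj₂ r (trans e (cong (_+ + N) fixed))))
          (trans e (cong (_+ + N) (sym (raise-no ¬r))))

      -- Either k is still a fixed point, or k is no longer a value.
      raise-notShift : ∀ t → t ≢ 0ℤ → ¬ (∀ j → raise j ≡ j - t)
      raise-notShift t t≢0 shift = go (app g k ≟ k)
        where
        lem : ∀ a b → a ≡ a + - b → b ≡ 0ℤ
        lem a b e = trans (cancel a b) (trans (cong (λ c → - c + a) (sym e)) (+-inverseˡ a))
          where
          cancel : ∀ a b → b ≡ - (a + - b) + a
          cancel = solve-∀
        cancel : ∀ a b → a + b + - b ≡ a
        cancel = solve-∀

        go : Dec (app g k ≡ k) → ⊥
        go (yes gk≡k) = t≢0 (lem k t (trans (sym gk≡k)
          (trans (sym (raise-no λ r → proj₂ r gk≡k)) (shift k))))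
        go (no gk≢k) = at (k + t) (trans (shift (k + t)) (cancel k t))
          where
          at : ∀ j → raise j ≡ k → ⊥
          at j rj≡k with raised? j
          ... | yes (gj≅k , _) = ≇-suc (≅-trans gj≅k (≅-reflexive (sym rj≡k)))
          ... | no ¬r with app g j ≟ j
          ...   | yes gj≡j = gk≢k (subst (λ j → app g j ≡ j) (trans (sym gj≡j) rj≡k) gj≡j)
          ...   | no gj≢j  = ¬r (≅-reflexive rj≡k , gj≢j)

      raised : NDPF
      raised = record
        { app             = raise
        ; regressive      = reg
        ; orderPreserving = mono
        ; skewPeriodic    = skew
        ; notShift        = raise-notShift
        }

      -- The raised values are lowered back, and no other value is touched because `g` skips the
      -- class of `k + 1ℤ`.
      f-raise : ∀ i → ι i ≅ k → ∀ j → f-fun i (raise j) ≡ app g j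
      f-raise i i≅k j = go (raised? j)
        where
        skip : ¬ app g j ≅ k + 1ℤ
        skip p with ≅⇒shift p
        ... | m , e = gap-skips g (gap-shift g m gap) j
              (trans e (sym (trans
                (cong (_+ 1ℤ) (skew-shift (app g) (skewPeriodic g) j₀ m))
                (shift+1 k m))))

        go : Dec (Raised j) → f-fun i (raise j) ≡ app g j
        go (yes r) = trans (cong (f-fun i) (raise-yes r))
          (trans (f-hit i (≅-+ 1ℤ (≅-trans (proj₁ r) (≅-sym i≅k)))) (i+1-1≡i (app g j)))
        go (no ¬r) = trans (cong (f-fun i) (raise-no ¬r))
          (f-miss i λ p → skip (≅-trans p (≅-+ 1ℤ i≅k)))

    raise-< : ∀ g {j} (gap : Gap g j) →
      windowSum (app g) < windowSum (app (Raise.raised g j gap))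
    raise-< g {j} gap = windowSum-mono-< (skewPeriodic g) skew g≤raise {j}
      (subst (k <_) (sym (raise-yes j₀-raised)) (i<i+1 k))
      where open Raise g j gap

    gap? : ∀ g j → Dec (Gap g j)
    gap? g j = app g j + 1ℤ <? app g (j + 1ℤ)

    -- Without gaps j ↦ g j - j is nonincreasing and N-periodic, hence constant.
    module NoGap (g : NDPF) (noGap : ∀ j → ¬ Gap g j) where

      growth : ∀ j k → app g (j + + k) ≤ app g j + + k
      growth j zero    = ≤-reflexive
        (trans (cong (app g) (+-identityʳ j)) (sym (+-identityʳ (app g j))))
      growth j (suc k) = begin
        app g (j + + suc k)     ≡⟨ cong (app g) (lem j (+ k)) ⟩
        app g (j + + k + 1ℤ)    ≤⟨ ≮⇒≥ (noGap (j + + k)) ⟩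
        app g (j + + k) + 1ℤ    ≤⟨ +-monoˡ-≤ 1ℤ (growth j k) ⟩
        app g j + + k + 1ℤ      ≡⟨ lem (app g j) (+ k) ⟨
        app g j + + suc k       ∎
        where
        open ≤-Reasoning
        lem : ∀ a k → a + (1ℤ + k) ≡ a + k + 1ℤ
        lem = solve-∀

      defect-≤ : ∀ i j → app g i - i ≤ app g j - j
      defect-≤ i j with reach i j
      ... | m , k , e = +-cancelʳ-≤ (i + + m * + N) (begin
        app g i - i + (i + + m * + N)  ≡⟨ lem (app g i) i (+ m * + N) ⟩
        app g i + + m * + N            ≡⟨ skew-shift (app g) (skewPeriodic g) i (+ m) ⟨
        app g (i + + m * + N)          ≡⟨ cong (app g) e ⟩
        app g (j + + k)                ≤⟨ growth j k ⟩
        app g j + + k                  ≡⟨ lem (app g j) j (+ k) ⟨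
        app g j - j + (j + + k)        ≡⟨ cong (λ c → app g j - j + c) e ⟨
        app g j - j + (i + + m * + N)  ∎)
        where
        open ≤-Reasoning
        lem : ∀ a i c → a + - i + (i + c) ≡ a + c
        lem = solve-∀

      isShift : ∀ j → app g j ≡ j - (- app g 0ℤ)
      isShift j = trans (lem (app g j) j)
        (trans (cong (_+ j) (≤-antisym (defect-≤ j 0ℤ) (defect-≤ 0ℤ j))) (lem′ (app g 0ℤ) j))
        where
        lem : ∀ a j → a ≡ a + - j + j
        lem = solve-∀
        lem′ : ∀ a j → a + 0ℤ + j ≡ j + - (- a)
        lem′ = solve-∀

      idF≈ : idF ≈F g
      idF≈ j with - app g 0ℤ ≟ 0ℤ
      ... | yes e = sym (trans (isShift j)
            (trans (cong (λ a → j - a) e) (+-identityʳ j)))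
      ... | no ne = contradiction isShift (notShift g _ ne)

    -- Raising at a gap increases the window sum, which regressivity bounds by that of the identity;
    -- the number `n` in `go` bounds the distance left. The new letter goes last because `f i` is
    -- applied after the raised function.
    P-surjective : ∀ g → ∃ λ u → P u ≈F g
    P-surjective g = let n , le = bounded in go n g le
      where
      top = windowSum (λ j → j)

      bounded : ∃ λ n → top ≤ windowSum (app g) + + n
      bounded = ∣ top - windowSum (app g) ∣ , (begin
        top                                           ≡⟨ lem top (windowSum (app g)) ⟩
        windowSum (app g) + (top - windowSum (app g)) ≤⟨ +-monoʳ-≤ (windowSum (app g)) i≤+∣i∣ ⟩
        windowSum (app g) + + ∣ top - windowSum (app g) ∣ ∎)
        where
        open ≤-Reasoning
        lem : ∀ a b → a ≡ b + (a + - b)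
        lem = solve-∀

      go : ∀ n g → top ≤ windowSum (app g) + + n → ∃ λ u → P u ≈F g
      go n g le with Fin.any? (λ i → gap? g (ι i))
      ... | no ¬gap = [] , NoGap.idF≈ g noGap
        where
        noGap : ∀ j → ¬ Gap g j
        noGap j gap with residue j
        ... | i , m , refl = ¬gap (i , subst (Gap g) (lem (ι i) m (+ N)) (gap-shift g (- m) gap))
          where
          lem : ∀ a m n → a + m * n + (- m) * n ≡ a
          lem = solve-∀
      go zero    g le | yes (i , gap) = contradiction (raise-< g gap)
        (≤⇒≯ (≤-trans (windowSum-mono-≤ (regressive (Raise.raised g (ι i) gap)))
          (subst (top ≤_) (+-identityʳ _) le)))
      go (suc n) g le | yes (j , gap) = let
          module R = Raise g (ι j) gap
          i , m , k≡ = residue R.k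
          ι≅k = ≅-sym (≅-trans (≅-reflexive k≡) (shift-≅ (ι i) m))
          u , e = go n R.raised (≤-trans le
            (≤-trans (≤-reflexive (lem (windowSum (app g)) (+ n)))
              (+-monoˡ-≤ (+ n) (<⇒+1≤ (raise-< g gap)))))
        in u ++ i ∷ [] , λ j → trans (P-++ u (i ∷ []) j)
             (trans (cong (f-fun i) (e j)) (R.f-raise i ι≅k j))
        where
        lem : ∀ a n → a + (1ℤ + n) ≡ a + 1ℤ + n
        lem = solve-∀

    -- Existence

    ≈F? : ∀ g h → Dec (g ≈F h)
    ≈F? g h = map′ extend (λ e i → e (ι i)) (Fin.all? λ i → app g (ι i) ≟ app h (ι i))
      where
      extend : (∀ i → app g (ι i) ≡ app h (ι i)) → g ≈F h
      extend e j with residue j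
      ... | i , m , refl = trans (skew-shift (app g) (skewPeriodic g) (ι i) m)
            (trans (cong (_+ m * + N) (e i))
              (sym (skew-shift (app h) (skewPeriodic h) (ι i) m)))

    anyOfLength? : ∀ {Q : Word → Set} → (∀ u → Dec (Q u)) → ∀ n →
      Dec (∃ λ u → length u ≡ n × Q u)
    anyOfLength? Q? zero    = map′ (λ q → [] , refl , q)
      (λ { ([] , _ , q) → q }) (Q? [])
    anyOfLength? Q? (suc n) = map′
      (λ { (i , u , e , q) → i ∷ u , cong suc e , q })
      (λ { (i ∷ u , e , q) → i , u , ℕ.suc-injective e , q })
      (Fin.any? λ i → anyOfLength? (λ u → Q? (i ∷ u)) n)

    -- There are finitely many words of each length, so lengths are tried upward; the length of the
    -- given word ends the search, and `d` bounds the steps left.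
    shortest : ∀ {Q : Word → Set} → (∀ u → Dec (Q u)) → ∀ u → Q u →
      ∃ λ v → Q v × (∀ w → Q w → length v ℕ.≤ length w)
    shortest {Q} Q? u q = go (length u) 0 (ℕ.m≤m+n _ 0) λ _ _ → ℕ.z≤n
      where
      go : ∀ d k → length u ℕ.≤ d ℕ.+ k → (∀ w → Q w → k ℕ.≤ length w) →
           ∃ λ v → Q v × (∀ w → Q w → length v ℕ.≤ length w)
      go d k u≤ k≤ with anyOfLength? Q? k
      go d k u≤ k≤ | yes (v , refl , qv) = v , qv , k≤
      go zero    k u≤ k≤ | no none =
        contradiction (u , ℕ.≤-antisym u≤ (k≤ u q) , q) none
      go (suc d) k u≤ k≤ | no none = go d (suc k)
        (subst (length u ℕ.≤_) (sym (ℕ.+-suc d k)) u≤)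
        λ w qw → ℕ.≤∧≢⇒< (k≤ w qw) λ e → none (w , sym e , qw)

    module _ (g : NDPF) where

      Shortest : Word → Set
      Shortest u = ∀ v → P v ≈F g → length u ℕ.≤ length v

      shortest-compatible : ∃ λ u → P u ≈F g × Shortest u × Compatible u
      shortest-compatible =
        let u₀ , e₀      = P-surjective g
            u , e , min  = shortest (λ u → ≈F? (P u) g) u₀ e₀
            v , v≤u , e′ , S = compatible-sameP u
        in v , (λ j → trans (e′ j) (e j)) , (λ w q → ℕ.≤-trans v≤u (min w q)) , S

      -- `P v` may differ from `g`. `compatible-samePerm` replaces `v` by a word that is sent to
      -- `g`, since for a compatible word the permutation determines `P`.
      shortest-suffixMin : ∀ u → Shortest u → ∀ v → SuffixMin (app g) (_· v) →
        length u ℕ.≤ length v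
      shortest-suffixMin u min v S =
        let w , w≤v , e , T = compatible-samePerm v
        in ℕ.≤-trans
          (min w (suffixMin-unique T (suffixMin-resp (λ _ → refl) (λ j → sym (e j)) S)))
          w≤v

      module _ (u : Word) (Pu≈g : P u ≈F g) (min : Shortest u) (S : Compatible u) where

        suffixMin-g : SuffixMin (app g) (_· u)
        suffixMin-g = suffixMin-resp Pu≈g (λ _ → refl) S

        shortest⇒reduced : Reduced u
        shortest⇒reduced v e = shortest-suffixMin u min v
          (suffixMin-resp (λ _ → refl) (λ j → sym (e j)) suffixMin-g)

        shortest⇒avoids321 : Avoids321 (affinePerm u)
        shortest⇒avoids321 (a , b , c , a<b , b<c , ub<ua , uc<ub) =
          let v , v<u , T = exchange u a<b ub<ua
          in ℕ.<⇒≱ v<u (shortest-suffixMin u min v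
               (suffixMin-transpose a<b b<c ub<ua uc<ub T suffixMin-g))

    -- Uniqueness

    module Avoiding (g : NDPF) (x : AffinePerm) (avoids : Avoids321 x)
                    (S : SuffixMin (app g) (fun x)) where

      open SuffixMin S

      injective : ∀ {p q} → fun x p ≡ fun x q → p ≡ q
      injective = proj₁ (AffinePerm.bijective x)

      -- If `g` jumps after `p`, the minimum over the ray from `p` is not attained later, hence at
      -- `p`.
      min-value : ∀ {p} → app g p ≢ app g (p + 1ℤ) → fun x p ≡ app g p
      min-value {p} ≢ with attained p
      ... | k , p≤k , e with p ≟ k
      ...   | yes refl = e
      ...   | no p≢k   = contradiction
              (≤-antisym (orderPreserving g (i≤i+j p 1ℤ))
                (subst (app g (p + 1ℤ) ≤_) e (bound (<⇒+1≤ (≤∧≢⇒< p≤k p≢k)))))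
              ≢

      nonMin-drop : ∀ {p} → app g p ≡ app g (p + 1ℤ) → ∃ λ k → p < k × fun x k < fun x p
      nonMin-drop {p} gp≡ with attained (p + 1ℤ)
      ... | k , p+1≤k , e = k , p<k , ≤∧≢⇒<
            (subst (_≤ fun x p) (trans gp≡ (sym e)) (bound ≤-refl))
            (λ e′ → <⇒≢ p<k (sym (injective e′)))
        where
        p<k = +1≤⇒< p+1≤k

      -- Only the later position has to be nonminimal: a smaller value after it would complete a
      -- drop from `p` to `q` to a 321 pattern.
      nonMin-increasing : ∀ {p q} → p < q → app g q ≡ app g (q + 1ℤ) → fun x p < fun x q
      nonMin-increasing {p} {q} p<q gq≡ with <-cmp (fun x p) (fun x q)
      ... | tri< xp<xq _ _ = xp<xq
      ... | tri≈ _ e _     = contradiction (injective e) (<⇒≢ p<q)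
      ... | tri> _ _ xq<xp = let k , q<k , xk<xq = nonMin-drop gq≡ in
            contradiction (p , q , k , p<q , q<k , xq<xp , xk<xq) avoids

    -- If y p < x p at one position p, then y < x at every position that is not
    -- a suffix minimum: the strict inequality propagates to the right, and by
    -- periodicity everywhere.  This contradicts the equality of window sums.
    module Compare (g : NDPF) (x y : AffinePerm)
                   (avoids-x : Avoids321 x) (avoids-y : Avoids321 y)
                   (Sx : SuffixMin (app g) (fun x)) (Sy : SuffixMin (app g) (fun y))
                   {p : ℤ} (yp<xp : fun y p < fun x p) where

      module X = Avoiding g x avoids-x Sx
      module Y = Avoiding g y avoids-y Sy

      NonMin : ℤ → Set
      NonMin q = app g q ≡ app g (q + 1ℤ)

      nonMin? : ∀ q → Dec (NonMin q)
      nonMin? q = app g q ≟ app g (q + 1ℤ)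

      min-agree : ∀ {q} → ¬ NonMin q → fun y q ≡ fun x q
      min-agree ¬n = trans (Y.min-value ¬n) (sym (X.min-value ¬n))

      nonMin-p : NonMin p
      nonMin-p with nonMin? p
      ... | yes n = n
      ... | no ¬n = contradiction (min-agree ¬n) (<⇒≢ yp<xp)

      -- `x` and `y` agree at the suffix minima, so `y` takes the value `x r` at a nonminimal
      -- position `t`. As `y` increases along these positions and y r < x r, `t` lies after `r`,
      -- thus t ≥ q, and y q ≤ y t = x r < x q.
      next : ∀ {r q} → NonMin r → NonMin q → r < q →
        (∀ t → NonMin t → r < t → q ≤ t) → fun y r < fun x r → fun y q < fun x q
      next {r} {q} nr nq r<q first yr<xr with proj₂ (AffinePerm.bijective y) (fun x r)
      ... | t , yt≡ = ≤-<-trans yq≤yt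
            (subst (_< fun x q) (sym yt≡xr) (X.nonMin-increasing r<q nq))
        where
        yt≡xr : fun y t ≡ fun x r
        yt≡xr = yt≡ refl

        nt : NonMin t
        nt with nonMin? t
        ... | yes n = n
        ... | no ¬n = subst NonMin
              (X.injective (trans (sym yt≡xr) (min-agree ¬n))) nr

        r<t : r < t
        r<t with <-cmp r t
        ... | tri< r<t _ _  = r<t
        ... | tri≈ _ refl _ = contradiction yt≡xr (<⇒≢ yr<xr)
        ... | tri> _ _ t<r  = contradiction (Y.nonMin-increasing t<r nr)
              (<-asym (subst (fun y r <_) (sym yt≡xr) yr<xr))

        yq≤yt : fun y q ≤ fun y t
        yq≤yt with q ≟ t
        ... | yes refl = ≤-refl
        ... | no q≢t   = <⇒≤ (Y.nonMin-increasing (≤∧≢⇒< (first t nt r<t) q≢t) nt)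

      suc≡ : ∀ k → p + + suc k ≡ p + + k + 1ℤ
      suc≡ k = trans (cong (λ c → p + c) (+-comm 1ℤ (+ k))) (sym (+-assoc p (+ k) 1ℤ))

      -- `r` is the last nonminimal position up to `p + + k`. Carrying it along spares a search for
      -- its successor, which is the next nonminimal position that `p + + k` meets.
      ahead : ∀ k → ∃ λ r → NonMin r × r ≤ p + + k ×
        (∀ t → NonMin t → r < t → p + + k < t) × fun y r < fun x r
      ahead zero    = p , nonMin-p , ≤-reflexive (sym (+-identityʳ p))
        , (λ t _ p<t → subst (_< t) (sym (+-identityʳ p)) p<t) , yp<xp
      ahead (suc k) with ahead k | nonMin? (p + + suc k)
      ... | r , nr , r≤ , none , yr<xr | yes n =
            p + + suc k , n , ≤-refl , (λ _ _ r<t → r<t)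
            , next nr n (≤-<-trans r≤ (+-monoʳ-< p (+<+ (ℕ.n<1+n k))))
                (λ t nt r<t → subst (_≤ t) (sym (suc≡ k)) (<⇒+1≤ (none t nt r<t))) yr<xr
      ... | r , nr , r≤ , none , yr<xr | no ¬n =
            r , nr , ≤-trans r≤ (+-monoʳ-≤ p (+≤+ (ℕ.n≤1+n k)))
            , (λ t nt r<t → ≤∧≢⇒<
                (subst (_≤ t) (sym (suc≡ k)) (<⇒+1≤ (none t nt r<t)))
                (λ e → ¬n (subst NonMin (sym e) nt)))
            , yr<xr

      nonMin-shift : ∀ {q} m → NonMin q → NonMin (q + m * + N)
      nonMin-shift {q} m n = trans (at q) (trans (cong (_+ m * + N) n)
        (sym (trans (cong (app g) (shift+1 q m)) (at (q + 1ℤ)))))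
        where
        at : ∀ q → app g (q + m * + N) ≡ app g q + m * + N
        at q = skew-shift (app g) (skewPeriodic g) q m

      -- Some translate of `q` equals `p + + k` for a natural k; being nonminimal, it is the
      -- position that `ahead` delivers there.
      nonMin-< : ∀ {q} → NonMin q → fun y q < fun x q
      nonMin-< {q} n with reach q p
      ... | m , k , e with ahead k
      ...   | r , nr , r≤ , none , yr<xr = +-cancelʳ-< (+ m * + N)
              (subst₂ _<_ (at y) (at x) (subst (λ c → fun y c < fun x c) r≡ yr<xr))
        where
        at : ∀ z → fun z (q + + m * + N) ≡ fun z q + + m * + N
        at z = skew-shift (fun z) (AffinePerm.periodic z) q (+ m)

        r≡ : r ≡ q + + m * + N
        r≡ with <-cmp r (q + + m * + N)
        ... | tri< r<q _ _ = contradiction (none _ (nonMin-shift (+ m) n) r<q)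
              (≤⇒≯ (≤-reflexive e))
        ... | tri≈ _ r≡q _ = r≡q
        ... | tri> _ _ q<r = contradiction q<r (≤⇒≯ (subst (r ≤_) (sym e) r≤))

      y≤x : ∀ q → fun y q ≤ fun x q
      y≤x q with nonMin? q
      ... | yes n = <⇒≤ (nonMin-< n)
      ... | no ¬n = ≤-reflexive (min-agree ¬n)

      impossible : ⊥
      impossible = <⇒≢
        (windowSum-mono-< (AffinePerm.periodic y) (AffinePerm.periodic x) y≤x yp<xp)
        (trans (AffinePerm.window y) (sym (AffinePerm.window x)))

    avoids321-unique : ∀ g x y → Avoids321 x → Avoids321 y →
      SuffixMin (app g) (fun x) → SuffixMin (app g) (fun y) → x ≈S y
    avoids321-unique g x y ax ay Sx Sy p = ≤-antisym
      (≮⇒≥ λ yp<xp → Compare.impossible g x y ax ay Sx Sy yp<xp)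
      (≮⇒≥ λ xp<yp → Compare.impossible g y x ay ax Sy Sx xp<yp)

    fiber-unique-321 : ∀ g → ∃! _≈S_ (λ w → w InFiberOver g × Avoids321 w)
    fiber-unique-321 g =
      let u , e , min , S = shortest-compatible g
          avoids = shortest⇒avoids321 g u e min S
      in affinePerm u
         , (reduced⇒inFiber g u e (shortest⇒reduced g u e min S) , avoids)
         , λ {y} (y∈ , avoids-y) → avoids321-unique g (affinePerm u) y avoids avoids-y
             (suffixMin-g g u e min S) (inFiber⇒suffixMin g y y∈)

open import Data.Nat using (ℕ; _≤_)
open import Data.Product using (_×_; ∃!)

mainTheorem5 : (N : ℕ) (3≤N : 3 ≤ N) →
    let open Affine N 3≤N in
    (g : NDPF) → ∃! _≈S_ (λ w → w InFiberOver g × Avoids321 w)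
mainTheorem5 = Fibers.fiber-unique-321
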